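{- Let $$f(q)=\sum_{n=0}^\infty \frac{q^{n^2}}{(-q;q)_n^2}$$ be Ramanujan's third order mock theta function. Then, as formal power series in $q$, $$f(q)=\frac{(q;q)_\infty}{(q^2;q^2)_\infty^2}\sum_{n=0}^\infty\ \sum_{m=-\lfloor n/2\rfloor}^{\lfloor n/2\rfloor}\operatorname{sgn}(m)\,q^{\frac12(n^2-3m^2)+\frac12(n-m)},$$ or, equivalently, $$\left(\sum_{n=0}^\infty q^{\frac12n(n+1)}\right) f(q)=\sum_{n=0}^\infty\ \sum_{m=-\lfloor n/2\rfloor}^{\lfloor n/2\rfloor}\operatorname{sgn}(m)\,q^{\frac12(n^2-3m^2)+\frac12(n-m)}.$$
   Context: Notation: $(a;q)_\infty=\prod_{k\ge 0}(1-aq^k)$, $(a;q)_n=\prod_{k=0}^{n-1}(1-aq^k)$. Here $\operatorname{sgn}(m)=1$ if $m\ge 0$ (in particular $\operatorname{sgn}(0)=1$) and $\operatorname{sgn}(m)=-1$ if $m<0$. $\lfloor x\rfloor$ is the integer part of $x$. -}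

module Defs where

open import Algebra.Bundles using (RawRing)
import Algebra.Definitions.RawSemiring as RawSemiringDefinitions
open import Data.Fin.Base using (Fin; zero; suc; toℕ)
open import Data.Fin.Properties using (toℕ<n; toℕ≤pred[n])
open import Data.Integer.Base as ℤ
  using (ℤ; +_; -[1+_]; 0ℤ; 1ℤ; ∣_∣; sign; _◃_; _⊖_)
open import Data.Integer.DivMod using (_/ℕ_)
import Data.Integer.Properties as ℤ
import Data.Integer.Solver as ℤSolver
open import Data.Nat.Base as ℕ using (ℕ; zero; suc; _≤_; _<_; _∸_; s≤s; z≤n; ⌊_/2⌋)
open import Data.Nat.DivMod using (_/_; m*n/n≡m; /-monoˡ-≤)
import Data.Nat.Properties as ℕ
import Data.Nat.Solver as ℕSolver
open import Data.Product.Base using (_,_; proj₁; proj₂; ∃-syntax)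
open import Data.Sum.Base using (inj₁; inj₂)
open import Data.Vec.Base using (Vec; []; _∷_; head; lookup)
open import Function.Base using (_∘_)
open import Level using (0ℓ)
open import Relation.Binary.PropositionalEquality

open import Algebra.Properties.CommutativeMonoid.Sum ℤ.+-0-commutativeMonoid
  using (sum-syntax; sum⁺-syntax; sum-cong-≗; sum-replicate-zero)

infix  8 -_
infixl 7 _*_ _•_
infixl 6 _+_ _-_
infix  4 _≈_

FPS : Set
FPS = ℕ → ℤ

_≈_ : FPS → FPS → Set
_≈_ = _≗_

0# 1# q : FPS
0# _ = 0ℤ

1# zero    = 1ℤ
1# (suc _) = 0ℤ

q zero    = 0ℤ
q (suc n) = 1# n

_+_ : FPS → FPS → FPS
(a + b) n = a n ℤ.+ b n

-_ : FPS → FPS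
(- a) n = ℤ.- a n

_-_ : FPS → FPS → FPS
a - b = a + (- b)

_•_ : ℤ → FPS → FPS
(c • a) n = c ℤ.* a n

_*_ : FPS → FPS → FPS
(a * b) n = ∑[ i ≤ n ] (a (toℕ i) ℤ.* b (n ∸ toℕ i))

rawRing : RawRing 0ℓ 0ℓ
rawRing = record
  { Carrier = FPS ; _≈_ = _≈_ ; _+_ = _+_ ; _*_ = _*_
  ; -_ = -_ ; 0# = 0# ; 1# = 1# }

open RawSemiringDefinitions (RawRing.rawSemiring rawRing) public using (_^_)

-- recipCoeffs a n = rₙ ∷ … ∷ r₀ , where r₀ = 1 and
-- rₙ₊₁ = − ∑_{i ≤ n} aᵢ₊₁ rₙ₋ᵢ .
recipCoeffs : FPS → (n : ℕ) → Vec ℤ (suc n)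
recipCoeffs a zero    = 1ℤ ∷ []
recipCoeffs a (suc n) =
  (ℤ.- (∑[ i ≤ n ] (a (suc (toℕ i)) ℤ.* lookup (recipCoeffs a n) i)))
  ∷ recipCoeffs a n

recip : (a : FPS) → .(a 0 ≡ 1ℤ) → FPS
recip a _ n = head (recipCoeffs a n)

*-recip : ∀ a (a₀ : a 0 ≡ 1ℤ) → a * recip a a₀ ≈ 1#
*-recip a a₀ zero rewrite a₀ = refl
*-recip a a₀ (suc n) = begin
  a 0 ℤ.* r (suc n) ℤ.+ (∑[ i ≤ n ] (a (suc (toℕ i)) ℤ.* r (n ∸ toℕ i)))
    ≡⟨ cong₂ (λ x y → x ℤ.* r (suc n) ℤ.+ y) a₀
         (sum-cong-≗ {suc n} λ i → cong (a (suc (toℕ i)) ℤ.*_) (sym (lookup-r n i))) ⟩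
  1ℤ ℤ.* (ℤ.- s) ℤ.+ s ≡⟨ cong (ℤ._+ s) (ℤ.*-identityˡ (ℤ.- s)) ⟩
  ℤ.- s ℤ.+ s          ≡⟨ ℤ.+-inverseˡ s ⟩
  0ℤ                   ∎
  where
  open ≡-Reasoning
  r : FPS
  r = recip a a₀
  s : ℤ
  s = ∑[ i ≤ n ] (a (suc (toℕ i)) ℤ.* lookup (recipCoeffs a n) i)
  lookup-r : ∀ n (i : Fin (suc n)) → lookup (recipCoeffs a n) i ≡ r (n ∸ toℕ i)
  lookup-r zero    zero    = refl
  lookup-r (suc n) zero    = refl
  lookup-r (suc n) (suc i) = lookup-r n i

OrderAtLeast : ℕ → FPS → Set
OrderAtLeast m a = ∀ k → k < m → a k ≡ 0ℤ

∑-zero : ∀ n {t : Fin n → ℤ} → (∀ i → t i ≡ 0ℤ) → ∑[ i < n ] t i ≡ 0ℤ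
∑-zero n t≡0 = trans (sum-cong-≗ t≡0) (sum-replicate-zero n)

order-* : ∀ {m n} a b → OrderAtLeast m a → OrderAtLeast n b →
          OrderAtLeast (m ℕ.+ n) (a * b)
order-* {m} {n} a b oa ob k k<m+n = ∑-zero (suc k) term
  where
  term : ∀ (i : Fin (suc k)) → a (toℕ i) ℤ.* b (k ∸ toℕ i) ≡ 0ℤ
  term i with ℕ.<-≤-connex (toℕ i) m
  ... | inj₁ i<m rewrite oa (toℕ i) i<m = refl
  ... | inj₂ m≤i = trans (cong (a (toℕ i) ℤ.*_) (ob _ k∸i<n)) (ℤ.*-zeroʳ (a (toℕ i)))
    where
    open ℕ.≤-Reasoning
    k∸i<n : k ∸ toℕ i < n
    k∸i<n = ℕ.+-cancelʳ-< (toℕ i) _ _ (begin-strict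
      k ∸ toℕ i ℕ.+ toℕ i ≡⟨ ℕ.m∸n+n≡m (toℕ≤pred[n] i) ⟩
      k                   <⟨ k<m+n ⟩
      m ℕ.+ n             ≤⟨ ℕ.+-monoˡ-≤ n m≤i ⟩
      toℕ i ℕ.+ n         ≡⟨ ℕ.+-comm (toℕ i) n ⟩
      n ℕ.+ toℕ i         ∎)

order-^ : ∀ b → b 0 ≡ 0ℤ → ∀ n → OrderAtLeast n (b ^ n)
order-^ b b₀ (suc n) = order-* {1} {n} b (b ^ n) order-b (order-^ b b₀ n)
  where
  order-b : OrderAtLeast 1 b
  order-b zero    _ = b₀
  order-b (suc _) (s≤s ())
order-^ b b₀ zero k ()

-- q-adic convergence: each coefficient is eventually constant.  The value of
-- lim does not depend on the chosen bounds N.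
Convergent : (ℕ → FPS) → Set
Convergent s = ∀ k → ∃[ N ] (∀ n → N ≤ n → s n k ≡ s N k)

lim : (s : ℕ → FPS) → Convergent s → FPS
lim s conv k = s (proj₁ (conv k)) k

private
  eventuallyConstant : ∀ (s : ℕ → ℤ) N → (∀ n → N ≤ n → s (suc n) ≡ s n) →
                       ∀ n → N ≤ n → s n ≡ s N
  eventuallyConstant s N step n N≤n =
    trans (cong s (sym (ℕ.m∸n+n≡m N≤n))) (go (n ∸ N))
    where
    go : ∀ d → s (d ℕ.+ N) ≡ s N
    go zero    = refl
    go (suc d) = trans (step (d ℕ.+ N) (ℕ.m≤n+m N d)) (go d)

partialSum : (ℕ → FPS) → ℕ → FPS
partialSum t zero    = 0#
partialSum t (suc n) = partialSum t n + t n

Summable : (ℕ → FPS) → Set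
Summable t = Convergent (partialSum t)

∑∞ : (t : ℕ → FPS) → Summable t → FPS
∑∞ t = lim (partialSum t)

eventuallyZero⇒summable : ∀ t → (∀ k → ∃[ N ] (∀ n → N ≤ n → t n k ≡ 0ℤ)) → Summable t
eventuallyZero⇒summable t ez k =
  proj₁ (ez k) , eventuallyConstant (λ n → partialSum t n k) _ λ n N≤n →
    trans (cong (λ z → partialSum t n k ℤ.+ z) (proj₂ (ez k) n N≤n)) (ℤ.+-identityʳ _)

order⇒summable : ∀ t → (∀ n → OrderAtLeast n (t n)) → Summable t
order⇒summable t o = eventuallyZero⇒summable t λ k → suc k , λ n → o n k

-- poch a b n = (a;b)ₙ  and  poch∞ a b _ = (a;b)_∞

poch : FPS → FPS → ℕ → FPS
poch a b zero    = 1#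
poch a b (suc n) = (1# - a * b ^ n) * poch a b n

poch-convergent : ∀ a b → b 0 ≡ 0ℤ → Convergent (poch a b)
poch-convergent a b b₀ k =
  suc k , eventuallyConstant (λ n → poch a b n k) (suc k) step
  where
  step : ∀ n → k < n → poch a b (suc n) k ≡ poch a b n k
  step n k<n = begin
    (1# - x) 0 ℤ.* p k ℤ.+ (∑[ i < k ] ((1# - x) (suc (toℕ i)) ℤ.* p (k ∸ suc (toℕ i))))
      ≡⟨ cong₂ ℤ._+_ (cong (λ z → (1ℤ ℤ.- z) ℤ.* p k) (order-x 0 (ℕ.≤-<-trans z≤n k<n)))
                     (∑-zero k tail≡0) ⟩
    1ℤ ℤ.* p k ℤ.+ 0ℤ ≡⟨ ℤ.+-identityʳ _ ⟩
    1ℤ ℤ.* p k        ≡⟨ ℤ.*-identityˡ (p k) ⟩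
    p k               ∎
    where
    open ≡-Reasoning
    p x : FPS
    p = poch a b n
    x = a * b ^ n
    order-x : OrderAtLeast n x
    order-x = order-* {0} {n} a (b ^ n) (λ _ ()) (order-^ b b₀ n)
    tail≡0 : ∀ (i : Fin k) → (1# - x) (suc (toℕ i)) ℤ.* p (k ∸ suc (toℕ i)) ≡ 0ℤ
    tail≡0 i rewrite order-x (suc (toℕ i)) (ℕ.≤-<-trans (toℕ<n i) k<n) = refl

poch∞ : (a b : FPS) → b 0 ≡ 0ℤ → FPS
poch∞ a b b₀ = lim (poch a b) (poch-convergent a b b₀)

poch-0 : ∀ a b → a 0 ≡ 0ℤ → ∀ n → poch a b n 0 ≡ 1ℤ
poch-0 a b a₀ zero = refl
poch-0 a b a₀ (suc n) rewrite a₀ | poch-0 a b a₀ n = refl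

^2-0 : ∀ a → a 0 ≡ 1ℤ → (a ^ 2) 0 ≡ 1ℤ
^2-0 a a₀ rewrite a₀ = refl

mockThetaDenominator : ℕ → FPS
mockThetaDenominator n = poch (- q) q n ^ 2

mockThetaDenominator-const : ∀ n → mockThetaDenominator n 0 ≡ 1ℤ
mockThetaDenominator-const n = ^2-0 (poch (- q) q n) (poch-0 (- q) q refl n)

mockThetaTerm : ℕ → FPS
mockThetaTerm n =
  q ^ (n ℕ.* n) * recip (mockThetaDenominator n) (mockThetaDenominator-const n)

mockTheta-summable : Summable mockThetaTerm
mockTheta-summable = order⇒summable mockThetaTerm λ n k k<n →
  order-* {n ℕ.* n} {0} (q ^ (n ℕ.* n))
    (recip (mockThetaDenominator n) (mockThetaDenominator-const n)) (order-^ q refl (n ℕ.* n)) (λ _ ())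
    k (ℕ.<-≤-trans k<n (ℕ.≤-trans (n≤n*n n) (ℕ.m≤m+n (n ℕ.* n) 0)))
  where
  n≤n*n : ∀ n → n ≤ n ℕ.* n
  n≤n*n zero    = z≤n
  n≤n*n (suc n) = ℕ.m≤m*n (suc n) (suc n)

mockThetaF : FPS
mockThetaF = ∑∞ mockThetaTerm mockTheta-summable

triangularTerm : ℕ → FPS
triangularTerm n = q ^ (n ℕ.* (n ℕ.+ 1) / 2)

triangular-summable : Summable triangularTerm
triangular-summable = order⇒summable triangularTerm λ n k k<n →
  order-^ q refl (n ℕ.* (n ℕ.+ 1) / 2) k (ℕ.<-≤-trans k<n (n≤T n))
  where
  n≤T : ∀ n → n ≤ n ℕ.* (n ℕ.+ 1) / 2
  n≤T zero    = z≤n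
  n≤T (suc n) = ℕ.≤-trans (ℕ.≤-reflexive (sym (m*n/n≡m (suc n) 2)))
    (/-monoˡ-≤ 2 (ℕ.*-monoʳ-≤ (suc n) (s≤s (ℕ.m≤n+m 1 n))))

triangularSum : FPS
triangularSum = ∑∞ triangularTerm triangular-summable

sgn : ℤ → ℤ
sgn m = sign m ◃ 1

twiceExponent : ℕ → ℤ → ℤ
twiceExponent n m =
  (+ n ℤ.* + n ℤ.- + 3 ℤ.* (m ℤ.* m)) ℤ.+ (+ n ℤ.- m)

-- The two halves ½(n²−3m²) and ½(n−m) need not be integers separately, so
-- only their sum is halved.  For |m| ≤ ⌊n/2⌋ the division is exact and ∣_∣
-- changes nothing: see exponent-exact.
exponent : ℕ → ℤ → ℕ
exponent n m = ∣ twiceExponent n m /ℕ 2 ∣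

private
  -- tri n = n(n+1)/2
  tri : ℕ → ℕ
  tri zero    = 0
  tri (suc n) = suc n ℕ.+ tri n

  tri-double : ∀ n → 2 ℕ.* tri n ≡ n ℕ.* n ℕ.+ n
  tri-double zero    = refl
  tri-double (suc n) = begin
    2 ℕ.* (suc n ℕ.+ tri n)           ≡⟨ ℕ.*-distribˡ-+ 2 (suc n) (tri n) ⟩
    2 ℕ.* suc n ℕ.+ 2 ℕ.* tri n       ≡⟨ cong (2 ℕ.* suc n ℕ.+_) (tri-double n) ⟩
    2 ℕ.* suc n ℕ.+ (n ℕ.* n ℕ.+ n)   ≡⟨ solve 1 (λ x → con 2 :* (con 1 :+ x) :+ (x :* x :+ x)
                                           := (con 1 :+ x) :* (con 1 :+ x) :+ (con 1 :+ x)) refl n ⟩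
    suc n ℕ.* suc n ℕ.+ suc n         ∎
    where
    open ≡-Reasoning
    open ℕSolver.+-*-Solver

  tri-doubleℤ : ∀ n → + 2 ℤ.* + tri n ≡ + n ℤ.* + n ℤ.+ + n
  tri-doubleℤ n = begin
    + 2 ℤ.* + tri n       ≡⟨ ℤ.pos-* 2 (tri n) ⟨
    + (2 ℕ.* tri n)       ≡⟨ cong +_ (tri-double n) ⟩
    + (n ℕ.* n) ℤ.+ + n   ≡⟨ cong (ℤ._+ + n) (ℤ.pos-* n n) ⟩
    + n ℤ.* + n ℤ.+ + n   ∎
    where open ≡-Reasoning

  -- For n = 2∣m∣ + d the exponent is half d m.
  half : ℕ → ℤ → ℕ
  half d (+ a)    = tri a ℕ.+ 2 ℕ.* (a ℕ.* d) ℕ.+ tri d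
  half d -[1+ b ] = tri a ℕ.+ 2 ℕ.* (a ℕ.* d) ℕ.+ tri d ℕ.+ a
    where
    a : ℕ
    a = suc b

  double-core : ∀ a d → + 2 ℤ.* + (tri a ℕ.+ 2 ℕ.* (a ℕ.* d) ℕ.+ tri d) ≡
    (+ a ℤ.* + a ℤ.+ + a) ℤ.+ + 4 ℤ.* (+ a ℤ.* + d) ℤ.+ (+ d ℤ.* + d ℤ.+ + d)
  double-core a d = begin
    + 2 ℤ.* (+ tri a ℤ.+ + (2 ℕ.* (a ℕ.* d)) ℤ.+ + tri d)
      ≡⟨ cong (λ z → + 2 ℤ.* (+ tri a ℤ.+ z ℤ.+ + tri d))
           (trans (ℤ.pos-* 2 (a ℕ.* d)) (cong (+ 2 ℤ.*_) (ℤ.pos-* a d))) ⟩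
    + 2 ℤ.* (+ tri a ℤ.+ + 2 ℤ.* (+ a ℤ.* + d) ℤ.+ + tri d)
      ≡⟨ solve 3 (λ x y z → con (+ 2) :* (x :+ con (+ 2) :* y :+ z)
           := con (+ 2) :* x :+ con (+ 4) :* y :+ con (+ 2) :* z) refl
           (+ tri a) (+ a ℤ.* + d) (+ tri d) ⟩
    + 2 ℤ.* + tri a ℤ.+ + 4 ℤ.* (+ a ℤ.* + d) ℤ.+ + 2 ℤ.* + tri d
      ≡⟨ cong₂ (λ x z → x ℤ.+ + 4 ℤ.* (+ a ℤ.* + d) ℤ.+ z) (tri-doubleℤ a) (tri-doubleℤ d) ⟩
    (+ a ℤ.* + a ℤ.+ + a) ℤ.+ + 4 ℤ.* (+ a ℤ.* + d) ℤ.+ (+ d ℤ.* + d ℤ.+ + d) ∎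
    where
    open ≡-Reasoning
    open ℤSolver.+-*-Solver

  half-double : ∀ d m → + 2 ℤ.* + half d m ≡ twiceExponent (∣ m ∣ ℕ.+ ∣ m ∣ ℕ.+ d) m
  half-double d (+ a) = trans (double-core a d)
    (solve 2 (λ x y →
      (x :* x :+ x) :+ con (+ 4) :* (x :* y) :+ (y :* y :+ y)
      := ((x :+ x :+ y) :* (x :+ x :+ y) :- con (+ 3) :* (x :* x)) :+ ((x :+ x :+ y) :- x))
      refl (+ a) (+ d))
    where open ℤSolver.+-*-Solver
  half-double d -[1+ b ] = trans (ℤ.*-distribˡ-+ (+ 2) (+ half d (+ a)) (+ a))
    (trans (cong (ℤ._+ + 2 ℤ.* + a) (double-core a d))
    (solve 2 (λ x y →
      (x :* x :+ x) :+ con (+ 4) :* (x :* y) :+ (y :* y :+ y) :+ con (+ 2) :* x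
      := ((x :+ x :+ y) :* (x :+ x :+ y) :- con (+ 3) :* ((:- x) :* (:- x)))
         :+ ((x :+ x :+ y) :- (:- x)))
      refl (+ a) (+ d)))
    where
    a : ℕ
    a = suc b
    open ℤSolver.+-*-Solver

  exponent-half : ∀ d m → exponent (∣ m ∣ ℕ.+ ∣ m ∣ ℕ.+ d) m ≡ half d m
  exponent-half d m = begin
    ∣ twiceExponent (∣ m ∣ ℕ.+ ∣ m ∣ ℕ.+ d) m /ℕ 2 ∣ ≡⟨ cong (λ z → ∣ z /ℕ 2 ∣) (half-double d m) ⟨
    ∣ (+ 2 ℤ.* + half d m) /ℕ 2 ∣  ≡⟨ cong (λ z → ∣ z /ℕ 2 ∣) (ℤ.*-comm (+ 2) (+ half d m)) ⟩
    ∣ (+ half d m ℤ.* + 2) /ℕ 2 ∣  ≡⟨ cong (λ z → ∣ z /ℕ 2 ∣) (ℤ.pos-* (half d m) 2) ⟨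
    half d m ℕ.* 2 / 2             ≡⟨ m*n/n≡m (half d m) 2 ⟩
    half d m                       ∎
    where open ≡-Reasoning

  half-lower : ∀ d m → ∣ m ∣ ℕ.+ ∣ m ∣ ℕ.+ d ≤ 2 ℕ.* half d m
  half-lower d m = begin
    ∣ m ∣ ℕ.+ ∣ m ∣ ℕ.+ d
      ≤⟨ ℕ.+-mono-≤ (a+a≤ ∣ m ∣) (ℕ.≤-trans (ℕ.m≤n+m d (d ℕ.* d)) (ℕ.≤-reflexive (sym (tri-double d)))) ⟩
    2 ℕ.* tri ∣ m ∣ ℕ.+ 2 ℕ.* tri d ≡⟨ ℕ.*-distribˡ-+ 2 (tri ∣ m ∣) (tri d) ⟨
    2 ℕ.* (tri ∣ m ∣ ℕ.+ tri d)     ≤⟨ ℕ.*-monoʳ-≤ 2 (core m) ⟩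
    2 ℕ.* half d m                  ∎
    where
    open ℕ.≤-Reasoning
    a+a≤ : ∀ a → a ℕ.+ a ≤ 2 ℕ.* tri a
    a+a≤ zero    = z≤n
    a+a≤ (suc b) = ℕ.≤-trans (ℕ.+-monoˡ-≤ (suc b) (ℕ.m≤m*n (suc b) (suc b)))
                             (ℕ.≤-reflexive (sym (tri-double (suc b))))
    core : ∀ m → tri ∣ m ∣ ℕ.+ tri d ≤ half d m
    core (+ a)    = ℕ.+-monoˡ-≤ (tri d) (ℕ.m≤m+n (tri a) _)
    core -[1+ b ] = ℕ.≤-trans (ℕ.+-monoˡ-≤ (tri d) (ℕ.m≤m+n (tri (suc b)) _)) (ℕ.m≤m+n _ (suc b))

  gap : ∀ n m → ∣ m ∣ ≤ ⌊ n /2⌋ → ∃[ d ] ∣ m ∣ ℕ.+ ∣ m ∣ ℕ.+ d ≡ n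
  gap n m m≤ = n ∸ (∣ m ∣ ℕ.+ ∣ m ∣) , ℕ.m+[n∸m]≡n (begin
    ∣ m ∣ ℕ.+ ∣ m ∣              ≤⟨ ℕ.+-mono-≤ m≤ (ℕ.≤-trans m≤ (ℕ.⌊n/2⌋≤⌈n/2⌉ n)) ⟩
    ⌊ n /2⌋ ℕ.+ ℕ.⌈ n /2⌉        ≡⟨ ℕ.⌊n/2⌋+⌈n/2⌉≡n n ⟩
    n                            ∎)
    where open ℕ.≤-Reasoning

exponent-exact : ∀ n m → ∣ m ∣ ≤ ⌊ n /2⌋ → + 2 ℤ.* + exponent n m ≡ twiceExponent n m
exponent-exact n m m≤ with gap n m m≤
... | d , refl = trans (cong (λ e → + 2 ℤ.* + e) (exponent-half d m)) (half-double d m)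

exponent-lower : ∀ n m → ∣ m ∣ ≤ ⌊ n /2⌋ → n ≤ 2 ℕ.* exponent n m
exponent-lower n m m≤ with gap n m m≤
... | d , refl = subst (λ e → ∣ m ∣ ℕ.+ ∣ m ∣ ℕ.+ d ≤ 2 ℕ.* e) (sym (exponent-half d m)) (half-lower d m)

-- ∑± N t = ∑_{m = −N}^{N} t m
∑± : ℕ → (ℤ → FPS) → FPS
∑± N t k = ∑[ i ≤ 2 ℕ.* N ] t (toℕ i ⊖ N) k

heckeTerm : ℕ → FPS
heckeTerm n = ∑± ⌊ n /2⌋ λ m → sgn m • q ^ exponent n m

hecke-summable : Summable heckeTerm
hecke-summable = eventuallyZero⇒summable heckeTerm λ k →
  suc (2 ℕ.* k) , λ n 2k<n → ∑-zero (suc (2 ℕ.* ⌊ n /2⌋)) (vanish k n 2k<n)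
  where
  ∣i⊖N∣≤N : ∀ N (i : Fin (suc (2 ℕ.* N))) → ∣ toℕ i ⊖ N ∣ ≤ N
  ∣i⊖N∣≤N N i with ℕ.≤-total (toℕ i) N
  ... | inj₁ i≤N = ℕ.≤-trans (ℕ.≤-reflexive (ℤ.∣⊖∣-≤ i≤N)) (ℕ.m∸n≤m N (toℕ i))
  ... | inj₂ N≤i = begin
    ∣ toℕ i ⊖ N ∣       ≡⟨ cong ∣_∣ (ℤ.⊖-≥ N≤i) ⟩
    toℕ i ∸ N           ≤⟨ ℕ.∸-monoˡ-≤ N (toℕ≤pred[n] i) ⟩
    2 ℕ.* N ∸ N         ≡⟨ ℕ.m+n∸m≡n N (N ℕ.+ 0) ⟩
    N ℕ.+ 0             ≡⟨ ℕ.+-identityʳ N ⟩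
    N                   ∎
    where open ℕ.≤-Reasoning
  vanish : ∀ k n → 2 ℕ.* k < n → ∀ (i : Fin (suc (2 ℕ.* ⌊ n /2⌋))) →
    (sgn (toℕ i ⊖ ⌊ n /2⌋) • q ^ exponent n (toℕ i ⊖ ⌊ n /2⌋)) k ≡ 0ℤ
  vanish k n 2k<n i = trans (cong (sgn m ℤ.*_) (order-^ q refl (exponent n m) k k<e)) (ℤ.*-zeroʳ (sgn m))
    where
    m : ℤ
    m = toℕ i ⊖ ⌊ n /2⌋
    k<e : k < exponent n m
    k<e = ℕ.*-cancelˡ-< 2 k (exponent n m)
      (ℕ.<-≤-trans 2k<n (exponent-lower n m (∣i⊖N∣≤N ⌊ n /2⌋ i)))

heckeSum : FPS
heckeSum = ∑∞ heckeTerm hecke-summable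

⟨q⨾q⟩∞ : FPS
⟨q⨾q⟩∞ = poch∞ q q refl

⟨q²⨾q²⟩∞ : FPS
⟨q²⨾q²⟩∞ = poch∞ (q ^ 2) (q ^ 2) refl

⟨q²⨾q²⟩∞²-const : (⟨q²⨾q²⟩∞ ^ 2) 0 ≡ 1ℤ
⟨q²⨾q²⟩∞²-const = ^2-0 ⟨q²⨾q²⟩∞ (poch-0 (q ^ 2) (q ^ 2) refl 1)

{-# OPTIONS --safe #-}
module Submission where

-- Idea.  Let ψ(q) = ∑ q^{n(n+1)/2} and Wₙ = ψ(q)/(−q;q)ₙ², so that
-- ψ(q) f(q) = ∑ₙ q^{n²} Wₙ.  Up to sign Wₙ is (q;q)_∞ (zqⁿ⁺¹;q)_∞ (z⁻¹qⁿ⁺¹;q)_∞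
-- at z = −1, whose coefficient of z^{±k} is, again up to sign,
--   q^{nk+k(k+1)/2} Aₙ(q^k),  Aₙ(x) = ∑ⱼ (−1)ʲ q^{j(j+1)/2} xʲ [2n+j choose j].
-- The two Pascal rules give Wₙ = (1+qⁿ⁺¹)² Wₙ₊₁ and W₀ = ψ without any use of
-- infinite products, and they also show that Z(x) = ∑ₙ q^{n²} xⁿ Aₙ(x) satisfies
--   Z(x) = 1 − q²x² + q⁴x³ Z(q²x).
-- Iterating this evaluates ψ f = Z(1) + 2 ∑_{k≥1} q^{k(k+1)/2} Z(q^k) as the sum
-- along its diagonals of a symmetric double series, which is the Hecke series
-- after n = 2|m| + d.  Letting n → ∞ in ψ = (−q;q)ₙ² Wₙ gives Gauss's product
-- for ψ, which turns the second form of the identity into the first.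

-- Neither x nor z is ever an indeterminate. Only the values x = q^s with s a natural number occur,
-- and z survives only as the index of its coefficients, so every functional equation becomes a
-- family of relations between integer power series indexed by natural numbers. The binomials enter
-- through Pascal rules alone and are never formed as quotients. The multiplier ψ is natural because
-- ψ = (q;q)_∞ (-q;q)²_∞: dividing by (-q;q)ₙ² strips the first n factors of a theta product, and
-- the coefficients in z of what remains are single sums over j. This product for ψ is only the
-- motivation. The Hecke form of ψ f is reached from the recurrences, and the product is proved
-- afterwards, modulo powers of q, for the sake of the quotient form.

open import Algebra.Bundles using (CommutativeRing)
import Algebra.Properties.Semiring.Exp as Exp
import Algebra.Solver.Ring
import Algebra.Solver.Ring.AlmostCommutativeRing as ACR
open import Data.Fin.Base using (Fin; toℕ)
open import Data.Fin.Properties using (toℕ≤pred[n])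
open import Data.Integer.Base as ℤ using (ℤ; +_; -[1+_]; 0ℤ; 1ℤ; ∣_∣; _⊖_)
import Data.Integer.Properties as ℤ
import Data.Integer.Solver as ℤSolver
open import Data.Maybe.Base using (just; nothing)
open import Data.Nat.Base as ℕ using (ℕ; zero; suc; _≤_; _<_; _∸_; s≤s; z≤n; ⌊_/2⌋)
open import Data.Nat.DivMod using (_/_; m*n/n≡m)
import Data.Nat.Properties as ℕ
import Data.Nat.Solver as ℕSolver
open import Data.Product.Base using (_×_; _,_; proj₂)
open import Function.Base using (_∘_)
open import Level using (0ℓ)
open import Relation.Binary.Definitions using (WeaklyDecidable)
open import Relation.Binary.PropositionalEquality as ≡ using (_≡_)
import Relation.Binary.Reasoning.Setoid as SetoidReasoning
open import Relation.Nullary.Decidable using (yes; no)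
open import Defs

open import Algebra.Properties.CommutativeMonoid.Sum ℤ.+-0-commutativeMonoid
  using (sum-syntax; sum-cong-≗)

-- The ring of formal power series

-- By computation `(a * b) (suc n)` is `a 0 ℤ.* b (suc n) ℤ.+ (tail a * b) n`. The ring laws thus
-- follow by induction on the coefficient, with no manipulation of finite sums.
tail : FPS → FPS
tail a k = a (suc k)

*-cong : ∀ {a a′ b b′} → a ≈ a′ → b ≈ b′ → a * b ≈ a′ * b′
*-cong a≈a′ b≈b′ n =
  sum-cong-≗ {suc n} λ i → ≡.cong₂ ℤ._*_ (a≈a′ (toℕ i)) (b≈b′ (n ∸ toℕ i))

module _ where
  open ≡.≡-Reasoning
  open ℤSolver.+-*-Solver

  *-distribʳ : ∀ a b c → (b + c) * a ≈ b * a + c * a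
  *-distribʳ a b c zero =
    solve 3 (λ x y z → (y :+ z) :* x :+ con 0ℤ := (y :* x :+ con 0ℤ) :+ (z :* x :+ con 0ℤ))
      ≡.refl (a 0) (b 0) (c 0)
  *-distribʳ a b c (suc n) = begin
    (b 0 ℤ.+ c 0) ℤ.* a (suc n) ℤ.+ ((tail b + tail c) * a) n
      ≡⟨ ≡.cong (λ z → (b 0 ℤ.+ c 0) ℤ.* a (suc n) ℤ.+ z) (*-distribʳ a (tail b) (tail c) n) ⟩
    (b 0 ℤ.+ c 0) ℤ.* a (suc n) ℤ.+ ((tail b * a) n ℤ.+ (tail c * a) n)
      ≡⟨ solve 5 (λ x y z u v → (y :+ z) :* x :+ (u :+ v) := (y :* x :+ u) :+ (z :* x :+ v))
           ≡.refl (a (suc n)) (b 0) (c 0) ((tail b * a) n) ((tail c * a) n) ⟩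
    (b * a + c * a) (suc n) ∎

  •-*-assoc : ∀ c a b → (c • a) * b ≈ c • (a * b)
  •-*-assoc c a b zero =
    solve 3 (λ x y z → (x :* y) :* z :+ con 0ℤ := x :* (y :* z :+ con 0ℤ)) ≡.refl c (a 0) (b 0)
  •-*-assoc c a b (suc n) = begin
    c ℤ.* a 0 ℤ.* b (suc n) ℤ.+ ((c • tail a) * b) n
      ≡⟨ ≡.cong (λ z → c ℤ.* a 0 ℤ.* b (suc n) ℤ.+ z) (•-*-assoc c (tail a) b n) ⟩
    c ℤ.* a 0 ℤ.* b (suc n) ℤ.+ c ℤ.* (tail a * b) n
      ≡⟨ solve 4 (λ x y z u → x :* y :* z :+ x :* u := x :* (y :* z :+ u))
           ≡.refl c (a 0) (b (suc n)) ((tail a * b) n) ⟩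
    (c • (a * b)) (suc n) ∎

  *-assoc : ∀ a b c → (a * b) * c ≈ a * (b * c)
  *-assoc a b c zero =
    solve 3 (λ x y z → (x :* y :+ con 0ℤ) :* z :+ con 0ℤ := x :* (y :* z :+ con 0ℤ) :+ con 0ℤ)
      ≡.refl (a 0) (b 0) (c 0)
  *-assoc a b c (suc n) = begin
    (a 0 ℤ.* b 0 ℤ.+ 0ℤ) ℤ.* c (suc n) ℤ.+ ((a 0 • tail b + tail a * b) * c) n
      ≡⟨ ≡.cong (λ z → first ℤ.+ z) (*-distribʳ c (a 0 • tail b) (tail a * b) n) ⟩
    first ℤ.+ (((a 0 • tail b) * c) n ℤ.+ ((tail a * b) * c) n)
      ≡⟨ ≡.cong₂ (λ x y → first ℤ.+ (x ℤ.+ y)) (•-*-assoc (a 0) (tail b) c n) (*-assoc (tail a) b c n) ⟩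
    first ℤ.+ (a 0 ℤ.* (tail b * c) n ℤ.+ (tail a * (b * c)) n)
      ≡⟨ solve 5 (λ x y z u v → (x :* y :+ con 0ℤ) :* z :+ (x :* u :+ v) := x :* (y :* z :+ u) :+ v)
           ≡.refl (a 0) (b 0) (c (suc n)) ((tail b * c) n) ((tail a * (b * c)) n) ⟩
    (a * (b * c)) (suc n) ∎
    where
    first : ℤ
    first = (a 0 ℤ.* b 0 ℤ.+ 0ℤ) ℤ.* c (suc n)

  -- `tail` peels the left factor only. The induction therefore swaps at n + 1 to bring `b` to the
  -- left, peels it, swaps the two tails at n, and reassembles with another swap at n + 1. The
  -- descent by two is why coefficients 0 and 1 are separate cases.
  *-comm : ∀ a b → a * b ≈ b * a
  *-comm a b zero = ≡.cong (ℤ._+ 0ℤ) (ℤ.*-comm (a 0) (b 0))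
  *-comm a b (suc zero) =
    solve 4 (λ x y u v → x :* v :+ (y :* u :+ con 0ℤ) := u :* y :+ (v :* x :+ con 0ℤ))
      ≡.refl (a 0) (a 1) (b 0) (b 1)
  *-comm a b (suc (suc n)) = begin
    a 0 ℤ.* b (2 ℕ.+ n) ℤ.+ (tail a * b) (suc n)
      ≡⟨ ≡.cong (λ z → a 0 ℤ.* b (2 ℕ.+ n) ℤ.+ z) (*-comm (tail a) b (suc n)) ⟩
    a 0 ℤ.* b (2 ℕ.+ n) ℤ.+ (b 0 ℤ.* a (2 ℕ.+ n) ℤ.+ (tail b * tail a) n)
      ≡⟨ ≡.cong (λ z → a 0 ℤ.* b (2 ℕ.+ n) ℤ.+ (b 0 ℤ.* a (2 ℕ.+ n) ℤ.+ z)) (*-comm (tail b) (tail a) n) ⟩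
    a 0 ℤ.* b (2 ℕ.+ n) ℤ.+ (b 0 ℤ.* a (2 ℕ.+ n) ℤ.+ (tail a * tail b) n)
      ≡⟨ solve 5 (λ x y u v w → x :* v :+ (u :* y :+ w) := u :* y :+ (x :* v :+ w))
           ≡.refl (a 0) (a (2 ℕ.+ n)) (b 0) (b (2 ℕ.+ n)) ((tail a * tail b) n) ⟩
    b 0 ℤ.* a (2 ℕ.+ n) ℤ.+ (a * tail b) (suc n)
      ≡⟨ ≡.cong (λ z → b 0 ℤ.* a (2 ℕ.+ n) ℤ.+ z) (*-comm a (tail b) (suc n)) ⟩
    b 0 ℤ.* a (2 ℕ.+ n) ℤ.+ (tail b * a) (suc n) ∎

0#-* : ∀ a → 0# * a ≈ 0#
0#-* a n = ∑-zero (suc n) λ _ → ≡.refl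

*-identityˡ : ∀ a → 1# * a ≈ a
*-identityˡ a zero = ≡.trans (ℤ.+-identityʳ _) (ℤ.*-identityˡ (a 0))
*-identityˡ a (suc n) = ≡.trans
  (≡.cong₂ ℤ._+_ (ℤ.*-identityˡ (a (suc n))) (0#-* a n)) (ℤ.+-identityʳ _)

fpsRing : CommutativeRing 0ℓ 0ℓ
fpsRing = record
  { Carrier = FPS ; _≈_ = _≈_ ; _+_ = _+_ ; _*_ = _*_ ; -_ = -_ ; 0# = 0# ; 1# = 1#
  ; isCommutativeRing = record
    { isRing = record
      { +-isAbelianGroup = record
        { isGroup = record
          { isMonoid = record
            { isSemigroup = record
              { isMagma = record
                { isEquivalence = record
                  { refl  = λ _ → ≡.refl
                  ; sym   = λ p n → ≡.sym (p n)
                  ; trans = λ p r n → ≡.trans (p n) (r n)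
                  }
                ; ∙-cong = λ p r n → ≡.cong₂ ℤ._+_ (p n) (r n)
                }
              ; assoc = λ a b c n → ℤ.+-assoc (a n) (b n) (c n)
              }
            ; identity = (λ a n → ℤ.+-identityˡ (a n)) , (λ a n → ℤ.+-identityʳ (a n))
            }
          ; inverse = (λ a n → ℤ.+-inverseˡ (a n)) , (λ a n → ℤ.+-inverseʳ (a n))
          ; ⁻¹-cong = λ p n → ≡.cong ℤ.-_ (p n)
          }
        ; comm = λ a b n → ℤ.+-comm (a n) (b n)
        }
      ; *-cong = *-cong
      ; *-assoc = *-assoc
      ; *-identity = *-identityˡ , λ a n → ≡.trans (*-comm a 1# n) (*-identityˡ a n)
      ; distrib =
          (λ a b c n → ≡.trans (*-comm a (b + c) n) (≡.trans (*-distribʳ a b c n)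
             (≡.cong₂ ℤ._+_ (*-comm b a n) (*-comm c a n))))
        , *-distribʳ
      }
    ; *-comm = *-comm
    }
  }

scalar : ℤ → FPS
scalar (+ 0) = 0#
scalar (+ 1) = 1#
scalar c     = c • 1#

scalar-• : ∀ c → scalar c ≈ c • 1#
scalar-• (+ 0)             n       = ≡.refl
scalar-• (+ 1)             n       = ≡.sym (ℤ.*-identityˡ (1# n))
scalar-• (+ suc (suc c))   n       = ≡.refl
scalar-• -[1+ c ]          n       = ≡.refl

almostRing : ACR.AlmostCommutativeRing 0ℓ 0ℓ
almostRing = ACR.fromCommutativeRing fpsRing

-- Sending the literals 0 and 1 to 0# and 1# by computation lets the solver's
-- constants match these series definitionally.
scalarMorphism : ACR._-Raw-AlmostCommutative⟶_ (CommutativeRing.rawRing ℤ.+-*-commutativeRing) almostRing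
scalarMorphism = record
  { ⟦_⟧    = scalar
  ; +-homo = λ c d n → begin
      scalar (c ℤ.+ d) n             ≡⟨ scalar-• (c ℤ.+ d) n ⟩
      (c ℤ.+ d) ℤ.* 1# n             ≡⟨ ℤ.*-distribʳ-+ (1# n) c d ⟩
      c ℤ.* 1# n ℤ.+ d ℤ.* 1# n      ≡⟨ ≡.cong₂ ℤ._+_ (scalar-• c n) (scalar-• d n) ⟨
      (scalar c + scalar d) n        ∎
  ; *-homo = λ c d n → begin
      scalar (c ℤ.* d) n             ≡⟨ scalar-• (c ℤ.* d) n ⟩
      c ℤ.* d ℤ.* 1# n               ≡⟨ ℤ.*-assoc c d (1# n) ⟩
      c ℤ.* (d ℤ.* 1# n)             ≡⟨ ≡.cong (c ℤ.*_) (*-identityˡ (d • 1#) n) ⟨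
      (c • (1# * (d • 1#))) n        ≡⟨ •-*-assoc c 1# (d • 1#) n ⟨
      ((c • 1#) * (d • 1#)) n        ≡⟨ *-cong (scalar-• c) (scalar-• d) n ⟨
      (scalar c * scalar d) n        ∎
  ; -‿homo = λ c n → begin
      scalar (ℤ.- c) n               ≡⟨ scalar-• (ℤ.- c) n ⟩
      ℤ.- c ℤ.* 1# n                 ≡⟨ ℤ.neg-distribˡ-* c (1# n) ⟨
      ℤ.- (c ℤ.* 1# n)               ≡⟨ ≡.cong ℤ.-_ (scalar-• c n) ⟨
      (- scalar c) n                 ∎
  ; 0-homo = λ _ → ≡.refl
  ; 1-homo = λ _ → ≡.refl
  }
  where open ≡.≡-Reasoning

coeff≟ : WeaklyDecidable (ACR.Induced-equivalence scalarMorphism)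
coeff≟ c d with c ℤ.≟ d
... | yes c≡d = just λ n → ≡.cong (λ e → scalar e n) c≡d
... | no _    = nothing

module Solver = Algebra.Solver.Ring
  (CommutativeRing.rawRing ℤ.+-*-commutativeRing) almostRing scalarMorphism coeff≟

module R = CommutativeRing fpsRing
open Exp R.semiring using (^-homo-*; ^-congˡ)
module ≡R = ≡.≡-Reasoning
module ≈-Reasoning = SetoidReasoning R.setoid
open Solver using (solve; con; _:+_; _:*_; _:-_; :-_; _:=_)

X : ℕ → FPS
X n = q ^ n

X-≡ : ∀ {m n} → m ≡ n → X m ≈ X n
X-≡ ≡.refl _ = ≡.refl

X-+ : ∀ m n → X (m ℕ.+ n) ≈ X m * X n
X-+ = ^-homo-* q

order-X* : ∀ e a → OrderAtLeast e (X e * a)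
order-X* e a k k<e = order-* {e} {0} (X e) a (order-^ q ≡.refl e) (λ _ ()) k
  (ℕ.<-≤-trans k<e (ℕ.m≤m+n e 0))

+-congˡ : ∀ a {b c} → b ≈ c → a + b ≈ a + c
+-congˡ a b≈c k = ≡.cong (λ z → a k ℤ.+ z) (b≈c k)

+-congʳ : ∀ a {b c} → b ≈ c → b + a ≈ c + a
+-congʳ a b≈c k = ≡.cong (ℤ._+ a k) (b≈c k)

*-congˡ : ∀ a {b c} → b ≈ c → a * b ≈ a * c
*-congˡ a = *-cong {a} (λ _ → ≡.refl)

*-congʳ : ∀ a {b c} → b ≈ c → b * a ≈ c * a
*-congʳ a b≈c = *-cong {b = a} b≈c (λ _ → ≡.refl)

-- Finite and infinite sums

partialSum-cong : ∀ {s t : ℕ → FPS} k → (∀ n → s n k ≡ t n k) →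
  ∀ n → partialSum s n k ≡ partialSum t n k
partialSum-cong k s≈t zero    = ≡.refl
partialSum-cong k s≈t (suc n) = ≡.cong₂ ℤ._+_ (partialSum-cong k s≈t n) (s≈t n)

partialSum-0 : ∀ {t : ℕ → FPS} k → (∀ n → t n k ≡ 0ℤ) → ∀ n → partialSum t n k ≡ 0ℤ
partialSum-0 k t≡0 zero    = ≡.refl
partialSum-0 k t≡0 (suc n) = ≡.cong₂ ℤ._+_ (partialSum-0 k t≡0 n) (t≡0 n)

partialSum-+ : ∀ (s t : ℕ → FPS) n → partialSum (λ i → s i + t i) n ≈ partialSum s n + partialSum t n
partialSum-+ s t zero    = λ _ → ≡.refl
partialSum-+ s t (suc n) = begin
  partialSum (λ i → s i + t i) n + (s n + t n)
    ≈⟨ R.+-congʳ (partialSum-+ s t n) ⟩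
  (partialSum s n + partialSum t n) + (s n + t n)
    ≈⟨ solve 4 (λ a b c d → (a :+ b) :+ (c :+ d) := (a :+ c) :+ (b :+ d)) (λ _ → ≡.refl)
         (partialSum s n) (partialSum t n) (s n) (t n) ⟩
  partialSum s (suc n) + partialSum t (suc n) ∎
  where open ≈-Reasoning

partialSum-* : ∀ a (t : ℕ → FPS) n → a * partialSum t n ≈ partialSum (λ i → a * t i) n
partialSum-* a t zero    = R.zeroʳ a
partialSum-* a t (suc n) = R.trans (R.distribˡ a (partialSum t n) (t n))
  (R.+-congʳ (partialSum-* a t n))

partialSum-head : ∀ (t : ℕ → FPS) n → partialSum t (suc n) ≈ t 0 + partialSum (t ∘ suc) n
partialSum-head t zero    = R.+-comm 0# (t 0)
partialSum-head t (suc n) = R.trans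
  (R.+-congʳ (partialSum-head t n)) (R.+-assoc (t 0) (partialSum (t ∘ suc) n) (t (suc n)))

partialSum-swap : ∀ (f : ℕ → ℕ → FPS) m n →
  partialSum (λ i → partialSum (f i) n) m ≈ partialSum (λ j → partialSum (λ i → f i j) m) n
partialSum-swap f zero    n k = ≡.sym (partialSum-0 k (λ _ → ≡.refl) n)
partialSum-swap f (suc m) n = R.trans (R.+-congʳ (partialSum-swap f m n))
  (R.sym (partialSum-+ (λ j → partialSum (λ i → f i j) m) (f m) n))

partialSum-stable : ∀ (t : ℕ → FPS) k N → (∀ n → N ≤ n → t n k ≡ 0ℤ) →
  ∀ M → N ≤ M → partialSum t M k ≡ partialSum t N k
partialSum-stable t k N t≡0 M N≤M =
  ≡.trans (≡.cong (λ n → partialSum t n k) (≡.sym (ℕ.m∸n+n≡m N≤M))) (go (M ∸ N))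
  where
  go : ∀ d → partialSum t (d ℕ.+ N) k ≡ partialSum t N k
  go zero    = ≡.refl
  go (suc d) = ≡.trans (≡.cong₂ ℤ._+_ (go d) (t≡0 (d ℕ.+ N) (ℕ.m≤n+m N d))) (ℤ.+-identityʳ _)

-- Sum t is the q-adic sum for Vanishing t.  Its cut-off does not depend on t,
-- so that interchanging two sums needs no convergence hypothesis.

cutoff : ℕ → ℕ
cutoff k = 2 ℕ.+ 2 ℕ.* k

Sum : (ℕ → FPS) → FPS
Sum t k = partialSum t (cutoff k) k

record Vanishing (t : ℕ → FPS) : Set where
  constructor vanishing
  field vanishes : ∀ n k → cutoff k ≤ n → t n k ≡ 0ℤ

open Vanishing

-- The bound for which `cutoff` is made. The slack of one is forced by `YTerm m 0`, whose exponent
-- at j = 1 is still 0.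
order⇒vanishing : ∀ {t} (e : ℕ → ℕ) → (∀ n → n ≤ suc (2 ℕ.* e n)) →
  (∀ n → OrderAtLeast (e n) (t n)) → Vanishing t
order⇒vanishing e n≤ o .vanishes n k c≤n = o n k
  (ℕ.*-cancelˡ-< 2 k (e n) (ℕ.≤-pred (ℕ.≤-trans c≤n (n≤ n))))

X*-vanishing : ∀ (e : ℕ → ℕ) → (∀ n → n ≤ suc (2 ℕ.* e n)) → ∀ (t : ℕ → FPS) → Vanishing (λ n → X (e n) * t n)
X*-vanishing e n≤ t = order⇒vanishing e n≤ λ n → order-X* (e n) (t n)

vanishing-suc : ∀ {t} → Vanishing t → Vanishing (t ∘ suc)
vanishing-suc v .vanishes n k c≤n = vanishes v (suc n) k (ℕ.m≤n⇒m≤1+n c≤n)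

vanishing-cong : ∀ {s t} → (∀ n → s n ≈ t n) → Vanishing s → Vanishing t
vanishing-cong s≈t v .vanishes n k c≤n = ≡.trans (≡.sym (s≈t n k)) (vanishes v n k c≤n)

Sum-beyond : ∀ {t} → Vanishing t → ∀ k N → cutoff k ≤ N → partialSum t N k ≡ Sum t k
Sum-beyond {t} v k N c≤N = partialSum-stable t k (cutoff k) (λ n → vanishes v n k) N c≤N

∑∞≈Sum : ∀ {t} → Vanishing t → (s : Summable t) → ∑∞ t s ≈ Sum t
∑∞≈Sum {t} v s k with s k
... | N , stable = ≡.trans (≡.sym (stable (N ℕ.+ cutoff k) (ℕ.m≤m+n N _)))
  (Sum-beyond v k (N ℕ.+ cutoff k) (ℕ.m≤n+m _ N))

Sum-cong : ∀ {s t : ℕ → FPS} → (∀ n → s n ≈ t n) → Sum s ≈ Sum t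
Sum-cong s≈t k = partialSum-cong k (λ n → s≈t n k) (cutoff k)

Sum-+ : ∀ s t → Sum (λ n → s n + t n) ≈ Sum s + Sum t
Sum-+ s t k = partialSum-+ s t (cutoff k) k

Sum-swap : ∀ (f : ℕ → ℕ → FPS) → Sum (λ m → Sum (f m)) ≈ Sum (λ n → Sum (λ m → f m n))
Sum-swap f k = begin
  partialSum (λ m → Sum (f m)) c k                        ≡⟨ partialSum-cong k (λ _ → ≡.refl) c ⟩
  partialSum (λ m → partialSum (f m) c) c k               ≡⟨ partialSum-swap f c c k ⟩
  partialSum (λ n → partialSum (λ m → f m n) c) c k       ≡⟨ partialSum-cong k (λ _ → ≡.refl) c ⟩
  partialSum (λ n → Sum (λ m → f m n)) c k                ∎
  where
  open ≡.≡-Reasoning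
  c : ℕ
  c = cutoff k

-- Coefficient k of the product reads `Sum t` at all coefficients up to k, each with its own smaller
-- cut-off. Vanishing lets all of them be raised to `cutoff k`, after which the statement is finite.
Sum-* : ∀ a {t} → Vanishing t → a * Sum t ≈ Sum (λ n → a * t n)
Sum-* a {t} v k = ≡.trans (sum-cong-≗ {suc k} term) (partialSum-* a t (cutoff k) k)
  where
  term : ∀ (i : Fin (suc k)) →
    a (toℕ i) ℤ.* Sum t (k ∸ toℕ i) ≡ a (toℕ i) ℤ.* partialSum t (cutoff k) (k ∸ toℕ i)
  term i = ≡.cong (a (toℕ i) ℤ.*_) (≡.sym (Sum-beyond v (k ∸ toℕ i) (cutoff k)
    (ℕ.+-monoʳ-≤ 2 (ℕ.*-monoʳ-≤ 2 (ℕ.m∸n≤m k (toℕ i))))))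

Sum-head : ∀ {t} → Vanishing t → Sum t ≈ t 0 + Sum (t ∘ suc)
Sum-head {t} v k = ≡.trans (≡.sym (Sum-beyond v k (suc (cutoff k)) (ℕ.n≤1+n _)))
  (partialSum-head t (cutoff k) k)

vanishing-Sum : ∀ {f : ℕ → ℕ → FPS} → (∀ n → Vanishing (λ m → f m n)) → Vanishing (λ m → Sum (f m))
vanishing-Sum v .vanishes m k c≤m = partialSum-0 k (λ n → vanishes (v n) m k c≤m) (cutoff k)

vanishing-+ : ∀ {s t} → Vanishing s → Vanishing t → Vanishing (λ n → s n + t n)
vanishing-+ u v .vanishes n k c≤n = ≡.cong₂ ℤ._+_ (vanishes u n k c≤n) (vanishes v n k c≤n)

Sum-telescope : ∀ {L t : ℕ → FPS} → (∀ i → L i ≈ t i + L (suc i)) → Vanishing L → L 0 ≈ Sum t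
Sum-telescope {L} {t} step v k = ≡.trans (unroll (cutoff k) k)
  (≡.trans (≡.cong (λ z → Sum t k ℤ.+ z) (vanishes v (cutoff k) k ℕ.≤-refl)) (ℤ.+-identityʳ _))
  where
  unroll : ∀ n → L 0 ≈ partialSum t n + L n
  unroll zero    = R.sym (R.+-identityˡ (L 0))
  unroll (suc n) = R.trans (unroll n) (R.trans (+-congˡ (partialSum t n) (step n))
    (R.sym (R.+-assoc (partialSum t n) (t n) (L (suc n)))))

-- Exponents of the Hecke series

module ℕS = ℕSolver.+-*-Solver
open ℕS using () renaming (solve to nsolve; con to ncon; _:+_ to _⊕_; _:*_ to _⊗_; _:=_ to _⊜_)

-- T n = n(n−1)/2, so that the n-th triangular number is T (suc n).
T : ℕ → ℕ
T zero    = 0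
T (suc n) = n ℕ.+ T n

n≤1+2T : ∀ n → n ≤ suc (2 ℕ.* T n)
n≤1+2T zero    = z≤n
n≤1+2T (suc n) = s≤s (ℕ.≤-trans (ℕ.m≤m+n n (T n)) (ℕ.m≤m+n (n ℕ.+ T n) _))

-- The exponent ½(n²−3m²) + ½(n−m) at n = 2m + d is E m d; at n = 2(m+1) + d
-- with m replaced by −(m+1) it is E m d + 2(m+d+1).
E : ℕ → ℕ → ℕ
E m d = T (suc m) ℕ.+ 2 ℕ.* (m ℕ.* d) ℕ.+ T (suc d)

E₂ : ℕ → ℕ → ℕ
E₂ m d = suc (m ℕ.+ d) ℕ.+ suc (m ℕ.+ d)

-- Writing the double as `a ℕ.* 2` makes it gain two constructors whenever `a` gains one, so `⌊_/2⌋`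
-- computes. For the same reason `n ℕ.* 2` in the first argument of `Y` passes from n to n + 1
-- definitionally.
a≤⌊a*2+d/2⌋ : ∀ a d → a ≤ ⌊ a ℕ.* 2 ℕ.+ d /2⌋
a≤⌊a*2+d/2⌋ zero    d = z≤n
a≤⌊a*2+d/2⌋ (suc a) d = s≤s (a≤⌊a*2+d/2⌋ a d)

module _ where
  open ≡.≡-Reasoning
  open ℤSolver.+-*-Solver using () renaming
    (solve to zsolve; con to zcon; _:+_ to _⊞_; _:*_ to _⊠_; _:-_ to _⊟_; :-_ to ⊟_; _:=_ to _⩵_)

  double-T : ∀ n → + 2 ℤ.* + T (suc n) ≡ + n ℤ.* + n ℤ.+ + n
  double-T zero    = ≡.refl
  double-T (suc n) = begin
    + 2 ℤ.* (+ suc n ℤ.+ + T (suc n))               ≡⟨ ℤ.*-distribˡ-+ (+ 2) (+ suc n) (+ T (suc n)) ⟩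
    + 2 ℤ.* + suc n ℤ.+ + 2 ℤ.* + T (suc n)         ≡⟨ ≡.cong (λ z → + 2 ℤ.* + suc n ℤ.+ z) (double-T n) ⟩
    + 2 ℤ.* (1ℤ ℤ.+ + n) ℤ.+ (+ n ℤ.* + n ℤ.+ + n)
      ≡⟨ zsolve 1 (λ x → zcon (+ 2) ⊠ (zcon 1ℤ ⊞ x) ⊞ (x ⊠ x ⊞ x)
           ⩵ (zcon 1ℤ ⊞ x) ⊠ (zcon 1ℤ ⊞ x) ⊞ (zcon 1ℤ ⊞ x)) ≡.refl (+ n) ⟩
    + suc n ℤ.* + suc n ℤ.+ + suc n                 ∎

  double-E : ∀ m d → + 2 ℤ.* + E m d ≡
    (+ m ℤ.* + m ℤ.+ + m) ℤ.+ + 4 ℤ.* (+ m ℤ.* + d) ℤ.+ (+ d ℤ.* + d ℤ.+ + d)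
  double-E m d = begin
    + 2 ℤ.* (+ T (suc m) ℤ.+ + (2 ℕ.* (m ℕ.* d)) ℤ.+ + T (suc d))
      ≡⟨ ≡.cong (λ z → + 2 ℤ.* (+ T (suc m) ℤ.+ z ℤ.+ + T (suc d)))
           (≡.trans (ℤ.pos-* 2 (m ℕ.* d)) (≡.cong (λ z → + 2 ℤ.* z) (ℤ.pos-* m d))) ⟩
    + 2 ℤ.* (+ T (suc m) ℤ.+ + 2 ℤ.* (+ m ℤ.* + d) ℤ.+ + T (suc d))
      ≡⟨ zsolve 3 (λ x y z → zcon (+ 2) ⊠ (x ⊞ zcon (+ 2) ⊠ y ⊞ z)
           ⩵ zcon (+ 2) ⊠ x ⊞ zcon (+ 4) ⊠ y ⊞ zcon (+ 2) ⊠ z) ≡.refl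
           (+ T (suc m)) (+ m ℤ.* + d) (+ T (suc d)) ⟩
    + 2 ℤ.* + T (suc m) ℤ.+ + 4 ℤ.* (+ m ℤ.* + d) ℤ.+ + 2 ℤ.* + T (suc d)
      ≡⟨ ≡.cong₂ (λ x z → x ℤ.+ + 4 ℤ.* (+ m ℤ.* + d) ℤ.+ z) (double-T m) (double-T d) ⟩
    (+ m ℤ.* + m ℤ.+ + m) ℤ.+ + 4 ℤ.* (+ m ℤ.* + d) ℤ.+ (+ d ℤ.* + d ℤ.+ + d) ∎

  exponent-unique : ∀ n m e → ∣ m ∣ ≤ ⌊ n /2⌋ → + 2 ℤ.* + e ≡ twiceExponent n m → exponent n m ≡ e
  exponent-unique n m e m≤ 2e≡ = ℤ.+-injective
    (ℤ.*-cancelˡ-≡ (+ 2) (+ exponent n m) (+ e) (≡.trans (exponent-exact n m m≤) (≡.sym 2e≡)))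

  exponent-+ : ∀ a d → exponent (a ℕ.* 2 ℕ.+ d) (+ a) ≡ E a d
  exponent-+ a d = exponent-unique (a ℕ.* 2 ℕ.+ d) (+ a) (E a d) (a≤⌊a*2+d/2⌋ a d) (begin
    + 2 ℤ.* + E a d
      ≡⟨ double-E a d ⟩
    (+ a ℤ.* + a ℤ.+ + a) ℤ.+ + 4 ℤ.* (+ a ℤ.* + d) ℤ.+ (+ d ℤ.* + d ℤ.+ + d)
      ≡⟨ zsolve 2 (λ x y → (x ⊠ x ⊞ x) ⊞ zcon (+ 4) ⊠ (x ⊠ y) ⊞ (y ⊠ y ⊞ y)
           ⩵ ((x ⊠ zcon (+ 2) ⊞ y) ⊠ (x ⊠ zcon (+ 2) ⊞ y) ⊟ zcon (+ 3) ⊠ (x ⊠ x))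
             ⊞ ((x ⊠ zcon (+ 2) ⊞ y) ⊟ x)) ≡.refl (+ a) (+ d) ⟩
    twice (+ a ℤ.* + 2 ℤ.+ + d)
      ≡⟨ ≡.cong (λ z → twice (z ℤ.+ + d)) (ℤ.pos-* a 2) ⟨
    twiceExponent (a ℕ.* 2 ℕ.+ d) (+ a) ∎)
    where
    twice : ℤ → ℤ
    twice n = (n ℤ.* n ℤ.- + 3 ℤ.* (+ a ℤ.* + a)) ℤ.+ (n ℤ.- + a)

  exponent-- : ∀ b d → exponent (suc b ℕ.* 2 ℕ.+ d) -[1+ b ] ≡ E b d ℕ.+ E₂ b d
  exponent-- b d = exponent-unique (suc b ℕ.* 2 ℕ.+ d) -[1+ b ] (E b d ℕ.+ E₂ b d) (a≤⌊a*2+d/2⌋ (suc b) d) (begin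
    + 2 ℤ.* (+ E b d ℤ.+ + E₂ b d)
      ≡⟨ ℤ.*-distribˡ-+ (+ 2) (+ E b d) (+ E₂ b d) ⟩
    + 2 ℤ.* + E b d ℤ.+ + 2 ℤ.* + E₂ b d
      ≡⟨ ≡.cong (λ z → z ℤ.+ + 2 ℤ.* + E₂ b d) (double-E b d) ⟩
    (+ b ℤ.* + b ℤ.+ + b) ℤ.+ + 4 ℤ.* (+ b ℤ.* + d) ℤ.+ (+ d ℤ.* + d ℤ.+ + d)
      ℤ.+ + 2 ℤ.* ((1ℤ ℤ.+ (+ b ℤ.+ + d)) ℤ.+ (1ℤ ℤ.+ (+ b ℤ.+ + d)))
      ≡⟨ zsolve 2 (λ x y → (x ⊠ x ⊞ x) ⊞ zcon (+ 4) ⊠ (x ⊠ y) ⊞ (y ⊠ y ⊞ y)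
             ⊞ zcon (+ 2) ⊠ ((zcon 1ℤ ⊞ (x ⊞ y)) ⊞ (zcon 1ℤ ⊞ (x ⊞ y)))
           ⩵ (((zcon 1ℤ ⊞ x) ⊠ zcon (+ 2) ⊞ y) ⊠ ((zcon 1ℤ ⊞ x) ⊠ zcon (+ 2) ⊞ y)
               ⊟ zcon (+ 3) ⊠ ((⊟ (zcon 1ℤ ⊞ x)) ⊠ (⊟ (zcon 1ℤ ⊞ x))))
             ⊞ (((zcon 1ℤ ⊞ x) ⊠ zcon (+ 2) ⊞ y) ⊟ (⊟ (zcon 1ℤ ⊞ x)))) ≡.refl (+ b) (+ d) ⟩
    twice (+ suc b ℤ.* + 2 ℤ.+ + d)
      ≡⟨ ≡.cong (λ z → twice (z ℤ.+ + d)) (ℤ.pos-* (suc b) 2) ⟨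
    twiceExponent (suc b ℕ.* 2 ℕ.+ d) -[1+ b ] ∎)
    where
    twice : ℤ → ℤ
    twice n = (n ℤ.* n ℤ.- + 3 ℤ.* (-[1+ b ] ℤ.* -[1+ b ])) ℤ.+ (n ℤ.- -[1+ b ])

open ≈-Reasoning

-- The series Y and its recurrences

-- c m j = (−1)ʲ [m+j−1 choose j]_q, the coefficient of yʲ in 1/(−y;q)ₘ.
c : ℕ → ℕ → FPS
c m       zero    = 1#
c zero    (suc j) = 0#
c (suc m) (suc j) = c m (suc j) - X m * c (suc m) j

-- Let G_m(y) = 1/(-y;q)_m be the generating function of `c m`. The definition of `c` removes the
-- last factor, (1 + q^m y) G_{m+1}(y) = G_m(y); this rule removes the first one, (1 + y) G_{m+1}(y)
-- = G_m(qy).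
c-pascal : ∀ m j → c (suc m) (suc j) ≈ X (suc j) * c m (suc j) - c (suc m) j
c-pascal zero j =
  solve 2 (λ x y → con 0ℤ :- con 1ℤ :* y := x :* con 0ℤ :- y) (λ _ → ≡.refl) (X (suc j)) (c 1 j)
c-pascal (suc m) zero = begin
  c (suc m) 1 - X (suc m) * 1#
    ≈⟨ +-congʳ (- (X (suc m) * 1#)) (c-pascal m 0) ⟩
  (X 1 * c m 1 - 1#) - X (suc m) * 1#
    ≈⟨ solve 3 (λ x y z → ((x :* con 1ℤ) :* y :- con 1ℤ) :- (x :* z) :* con 1ℤ
         := (x :* con 1ℤ) :* (y :- z :* con 1ℤ) :- con 1ℤ) (λ _ → ≡.refl) q (c m 1) (X m) ⟩
  X 1 * c (suc m) 1 - 1# ∎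
c-pascal (suc m) (suc j) = begin
  c (suc m) (2 ℕ.+ j) - X (suc m) * c (2 ℕ.+ m) (suc j)
    ≈⟨ R.+-cong (c-pascal m (suc j)) (R.-‿cong (*-congˡ (X (suc m)) (c-pascal (suc m) j))) ⟩
  (X (2 ℕ.+ j) * a - b) - X (suc m) * (X (suc j) * b - d)
    ≈⟨ solve 6 (λ x a b d y z → (x :* y :* a :- b) :- (x :* z) :* (y :* b :- d)
         := x :* y :* (a :- z :* b) :- (b :- (x :* z) :* d)) (λ _ → ≡.refl)
         q a b d (X (suc j)) (X m) ⟩
  X (2 ℕ.+ j) * (a - X m * b) - (b - X (suc m) * d) ∎
  where
  a b d : FPS
  a = c m (2 ℕ.+ j)
  b = c (suc m) (suc j)
  d = c (2 ℕ.+ m) j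

YTerm : ℕ → ℕ → ℕ → FPS
YTerm m s j = X (j ℕ.* s ℕ.+ T j) * c m j

-- Y (2n+1) (k+1) = Aₙ(qᵏ)
Y : ℕ → ℕ → FPS
Y m s = Sum (YTerm m s)

YTerm-vanishing : ∀ m s → Vanishing (YTerm m s)
YTerm-vanishing m s = X*-vanishing (λ j → j ℕ.* s ℕ.+ T j)
  (λ j → ℕ.≤-trans (n≤1+2T j) (s≤s (ℕ.*-monoʳ-≤ 2 (ℕ.m≤n+m (T j) (j ℕ.* s))))) (c m)

Y-zero : ∀ s → Y 0 s ≈ 1#
Y-zero s = begin
  Y 0 s                                       ≈⟨ Sum-head (YTerm-vanishing 0 s) ⟩
  1# * 1# + Sum (λ j → YTerm 0 s (suc j))     ≈⟨ R.+-cong (R.*-identityˡ 1#) rest ⟩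
  1# + 0#                                     ≈⟨ R.+-identityʳ 1# ⟩
  1#                                          ∎
  where
  rest : Sum (λ j → YTerm 0 s (suc j)) ≈ 0#
  rest k = partialSum-0 k (λ j → R.zeroʳ (X (suc j ℕ.* s ℕ.+ T (suc j))) k) (cutoff k)

private
  -- Common frame of the two recurrences: one Pascal rule splits the term of index j + 1 into a term
  -- of the same index and one of index j, while the terms of index 0 coincide.
  Y-split : ∀ m s s′ a →
    (∀ j → YTerm m s′ (suc j) ≈ YTerm (suc m) s (suc j) + a * YTerm (suc m) (suc s) j) →
    Y m s′ ≈ Y (suc m) s + a * Y (suc m) (suc s)
  Y-split m s s′ a step = begin
    Y m s′
      ≈⟨ Sum-head (YTerm-vanishing m s′) ⟩
    h + Sum (λ j → YTerm m s′ (suc j))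
      ≈⟨ +-congˡ h (Sum-cong step) ⟩
    h + Sum (λ j → YTerm (suc m) s (suc j) + a * YTerm (suc m) (suc s) j)
      ≈⟨ +-congˡ h (Sum-+ (λ j → YTerm (suc m) s (suc j)) (λ j → a * YTerm (suc m) (suc s) j)) ⟩
    h + (Sum (λ j → YTerm (suc m) s (suc j)) + Sum (λ j → a * YTerm (suc m) (suc s) j))
      ≈⟨ R.+-assoc h _ _ ⟨
    (h + Sum (λ j → YTerm (suc m) s (suc j))) + Sum (λ j → a * YTerm (suc m) (suc s) j)
      ≈⟨ R.+-cong (Sum-head (YTerm-vanishing (suc m) s)) (Sum-* a (YTerm-vanishing (suc m) (suc s))) ⟨
    Y (suc m) s + a * Y (suc m) (suc s) ∎
    where
    h : FPS
    h = X 0 * 1#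

  exponent-step : ∀ s j → suc j ℕ.* s ℕ.+ T (suc j) ≡ s ℕ.+ (j ℕ.* suc s ℕ.+ T j)
  exponent-step s j = ℕS.solve 3 (λ s j t →
    (s ℕS.:+ j ℕS.:* s) ℕS.:+ (j ℕS.:+ t) ℕS.:= s ℕS.:+ (j ℕS.:* (ℕS.con 1 ℕS.:+ s) ℕS.:+ t))
    ≡.refl s j (T j)

Y-recˡ : ∀ m s → Y m s ≈ Y (suc m) s + X (m ℕ.+ s) * Y (suc m) (suc s)
Y-recˡ m s = Y-split m s s (X (m ℕ.+ s)) λ j →
  let e = j ℕ.* suc s ℕ.+ T j
      x = X (suc j ℕ.* s ℕ.+ T (suc j))
      x≈ : x ≈ X s * X e
      x≈ = R.trans (X-≡ (exponent-step s j)) (X-+ s e)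
      a = c m (suc j)
      b = c (suc m) j
  in begin
  x * a
    ≈⟨ solve 4 (λ x a b y → x :* a := x :* (a :- y :* b) :+ y :* x :* b) (λ _ → ≡.refl) x a b (X m) ⟩
  x * (a - X m * b) + X m * x * b
    ≈⟨ +-congˡ (x * (a - X m * b)) (*-congʳ b (*-congˡ (X m) x≈)) ⟩
  x * (a - X m * b) + X m * (X s * X e) * b
    ≈⟨ +-congˡ (x * (a - X m * b)) (solve 4 (λ x y z b → x :* (y :* z) :* b := x :* y :* (z :* b))
         (λ _ → ≡.refl) (X m) (X s) (X e) b) ⟩
  x * (a - X m * b) + X m * X s * (X e * b)
    ≈⟨ +-congˡ (x * (a - X m * b)) (*-congʳ (X e * b) (X-+ m s)) ⟨
  x * (a - X m * b) + X (m ℕ.+ s) * (X e * b) ∎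

Y-recʳ : ∀ m s → Y m (suc s) ≈ Y (suc m) s + X s * Y (suc m) (suc s)
Y-recʳ m s = Y-split m s (suc s) (X s) λ j →
  let e = j ℕ.* suc s ℕ.+ T j
      x = X (suc j ℕ.* s ℕ.+ T (suc j))
      x≈ : x ≈ X s * X e
      x≈ = R.trans (X-≡ (exponent-step s j)) (X-+ s e)
      z = X (suc j)
      a = c m (suc j)
      b = c (suc m) j
  in begin
  X (suc j ℕ.* suc s ℕ.+ T (suc j)) * a
    ≈⟨ *-congʳ a (R.trans (X-≡ (ℕS.solve 3 (λ s j t →
         (ℕS.con 1 ℕS.:+ j) ℕS.:* (ℕS.con 1 ℕS.:+ s) ℕS.:+ t
         ℕS.:= (ℕS.con 1 ℕS.:+ j) ℕS.:+ ((ℕS.con 1 ℕS.:+ j) ℕS.:* s ℕS.:+ t)) ≡.refl s j (T (suc j))))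
         (X-+ (suc j) (suc j ℕ.* s ℕ.+ T (suc j)))) ⟩
  z * x * a
    ≈⟨ solve 4 (λ x a b z → z :* x :* a := x :* (z :* a :- b) :+ x :* b) (λ _ → ≡.refl) x a b z ⟩
  x * (z * a - b) + x * b
    ≈⟨ R.+-cong (*-congˡ x (R.sym (c-pascal m j))) (*-congʳ b x≈) ⟩
  x * c (suc m) (suc j) + X s * X e * b
    ≈⟨ +-congˡ (x * c (suc m) (suc j)) (R.*-assoc (X s) (X e) b) ⟩
  x * c (suc m) (suc j) + X s * (X e * b) ∎

-- `Y-recʳ` at s = 0 and `Y-recˡ` at s = 1 expand the same `Y m 1` and share the summand
-- `Y (suc m) 1`. For m = 2n this is the symmetry under z ↦ 1/z: it equates the coefficient formula
-- of `v n` at k = -1 with that at k = 1.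
Y-reflect : ∀ m → Y (suc m) 0 ≈ X (suc m) * Y (suc m) 2
Y-reflect m = begin
  Y₀                          ≈⟨ solve 2 (λ x y → x := (x :+ con 1ℤ :* y) :- y) (λ _ → ≡.refl) Y₀ Y₁ ⟩
  (Y₀ + X 0 * Y₁) - Y₁        ≈⟨ +-congʳ (- Y₁) (Y-recʳ m 0) ⟨
  Y m 1 - Y₁                  ≈⟨ +-congʳ (- Y₁) (Y-recˡ m 1) ⟩
  (Y₁ + X (m ℕ.+ 1) * Y₂) - Y₁
    ≈⟨ solve 2 (λ x y → (x :+ y) :- x := y) (λ _ → ≡.refl) Y₁ (X (m ℕ.+ 1) * Y₂) ⟩
  X (m ℕ.+ 1) * Y₂            ≈⟨ *-congʳ Y₂ (X-≡ (ℕ.+-comm m 1)) ⟩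
  X (suc m) * Y₂              ∎
  where
  Y₀ Y₁ Y₂ : FPS
  Y₀ = Y (suc m) 0
  Y₁ = Y (suc m) 1
  Y₂ = Y (suc m) 2

-- One right and one left recurrence raise m by two, that is n by one, and leave three terms centred
-- at s + 1. These match the three powers of z in (1 - zqⁿ⁺¹)(1 - z⁻¹qⁿ⁺¹).
Y-step : ∀ m s → Y m (suc s) ≈
  Y (2 ℕ.+ m) s + (1# + X (suc m)) * X s * Y (2 ℕ.+ m) (suc s)
    + X (suc m ℕ.+ suc s) * X s * Y (2 ℕ.+ m) (2 ℕ.+ s)
Y-step m s = begin
  Y m (suc s)
    ≈⟨ Y-recʳ m s ⟩
  Y (suc m) s + X s * Y (suc m) (suc s)
    ≈⟨ R.+-cong (Y-recˡ (suc m) s) (*-congˡ (X s) (Y-recˡ (suc m) (suc s))) ⟩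
  (Y₀ + X (suc m ℕ.+ s) * Y₁) + X s * (Y₁ + X (suc m ℕ.+ suc s) * Y₂)
    ≈⟨ +-congʳ _ (+-congˡ Y₀ (*-congʳ Y₁ (X-+ (suc m) s))) ⟩
  (Y₀ + X (suc m) * X s * Y₁) + X s * (Y₁ + X (suc m ℕ.+ suc s) * Y₂)
    ≈⟨ solve 6 (λ a b d x y z → (a :+ x :* y :* b) :+ y :* (b :+ z :* d)
         := a :+ (con 1ℤ :+ x) :* y :* b :+ z :* y :* d)
         (λ _ → ≡.refl) Y₀ Y₁ Y₂ (X (suc m)) (X s) (X (suc m ℕ.+ suc s)) ⟩
  Y₀ + (1# + X (suc m)) * X s * Y₁ + X (suc m ℕ.+ suc s) * X s * Y₂ ∎
  where
  Y₀ Y₁ Y₂ : FPS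
  Y₀ = Y (2 ℕ.+ m) s
  Y₁ = Y (2 ℕ.+ m) (suc s)
  Y₂ = Y (2 ℕ.+ m) (2 ℕ.+ s)

-- The weights W n = ψ(q)/(−q;q)ₙ²

n≤1+2e : ∀ {n e} → n ≤ e → n ≤ suc (2 ℕ.* e)
n≤1+2e n≤e = ℕ.m≤n⇒m≤1+n (ℕ.≤-trans n≤e (ℕ.m≤m+n _ _))

-- (q;q)_∞ (−qⁿ⁺¹;q)²_∞ = v n 0 + 2 ∑ₖ v n (k+1), where (−1)ᵏ v n k is the
-- coefficient of zᵏ and of z⁻ᵏ in (q;q)_∞ (zqⁿ⁺¹;q)_∞ (z⁻¹qⁿ⁺¹;q)_∞.
v : ℕ → ℕ → FPS
v n k = X (n ℕ.* k ℕ.+ T (suc k)) * Y (suc (n ℕ.* 2)) (suc k)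

W : ℕ → FPS
W n = v n 0 + (Sum (v n ∘ suc) + Sum (v n ∘ suc))

v-vanishing : ∀ n → Vanishing (v n)
v-vanishing n = X*-vanishing (λ k → n ℕ.* k ℕ.+ T (suc k))
  (λ k → n≤1+2e (ℕ.≤-trans (ℕ.m≤m+n k (T k)) (ℕ.m≤n+m _ (n ℕ.* k)))) (λ k → Y (suc (n ℕ.* 2)) (suc k))

v-zero : ∀ n → v n 0 ≈ Y (suc (n ℕ.* 2)) 1
v-zero n = R.trans (*-congʳ (Y (suc (n ℕ.* 2)) 1) (X-≡ (≡.cong (ℕ._+ 0) (ℕ.*-zeroʳ n))))
  (R.*-identityˡ (Y (suc (n ℕ.* 2)) 1))

-- Comparison of coefficients of z^{k+1} when the product at n is written as 1 + q^{2n+2} - qⁿ⁺¹(z +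
-- z⁻¹) times the product at n + 1. The signs (-1)ᵏ absorbed in `v` turn the minus into a plus.
v-step : ∀ n k → v n (suc k) ≈
  (1# + X (2 ℕ.+ n ℕ.* 2)) * v (suc n) (suc k) + X (suc n) * (v (suc n) k + v (suc n) (2 ℕ.+ k))
v-step n k = begin
  X e * Y m (2 ℕ.+ k)
    ≈⟨ *-congˡ (X e) (Y-step m (suc k)) ⟩
  X e * (y₀ + (1# + u) * X (suc k) * y₁ + X (suc m ℕ.+ (2 ℕ.+ k)) * X (suc k) * y₂)
    ≈⟨ solve 7 (λ x u k z y₀ y₁ y₂ → x :* (y₀ :+ (con 1ℤ :+ u) :* k :* y₁ :+ z :* k :* y₂)
         := (con 1ℤ :+ u) :* (x :* k :* y₁) :+ (x :* y₀ :+ x :* (z :* k) :* y₂)) (λ _ → ≡.refl)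
         (X e) u (X (suc k)) (X (suc m ℕ.+ (2 ℕ.+ k))) y₀ y₁ y₂ ⟩
  (1# + u) * (X e * X (suc k) * y₁)
    + (X e * y₀ + X e * (X (suc m ℕ.+ (2 ℕ.+ k)) * X (suc k)) * y₂)
    ≈⟨ R.+-cong (*-congˡ (1# + u) (*-congʳ y₁ x₁)) (R.+-cong (*-congʳ y₀ x₀) (*-congʳ y₂ x₂)) ⟩
  (1# + u) * v (suc n) (suc k) + (X (suc n) * X e₀ * y₀ + X (suc n) * X e₂ * y₂)
    ≈⟨ +-congˡ ((1# + u) * v (suc n) (suc k)) (solve 5 (λ p a b y₀ y₂ →
         p :* a :* y₀ :+ p :* b :* y₂ := p :* (a :* y₀ :+ b :* y₂)) (λ _ → ≡.refl)
         (X (suc n)) (X e₀) (X e₂) y₀ y₂) ⟩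
  (1# + u) * v (suc n) (suc k) + X (suc n) * (v (suc n) k + v (suc n) (2 ℕ.+ k)) ∎
  where
  m e e₀ e₂ : ℕ
  m = suc (n ℕ.* 2)
  e = n ℕ.* suc k ℕ.+ T (2 ℕ.+ k)
  e₀ = suc n ℕ.* k ℕ.+ T (suc k)
  e₂ = suc n ℕ.* (2 ℕ.+ k) ℕ.+ T (3 ℕ.+ k)
  u y₀ y₁ y₂ : FPS
  u  = X (2 ℕ.+ n ℕ.* 2)
  y₀ = Y (2 ℕ.+ m) (suc k)
  y₁ = Y (2 ℕ.+ m) (2 ℕ.+ k)
  y₂ = Y (2 ℕ.+ m) (3 ℕ.+ k)
  x₀ : X e ≈ X (suc n) * X e₀
  x₀ = R.trans (X-≡ (nsolve 3 (λ n k t →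
    n ⊗ (ncon 1 ⊕ k) ⊕ ((ncon 1 ⊕ k) ⊕ t) ⊜ (ncon 1 ⊕ n) ⊕ ((ncon 1 ⊕ n) ⊗ k ⊕ t))
    ≡.refl n k (T (suc k)))) (X-+ (suc n) e₀)
  x₁ : X e * X (suc k) ≈ X (suc n ℕ.* suc k ℕ.+ T (2 ℕ.+ k))
  x₁ = R.trans (R.sym (X-+ e (suc k))) (X-≡ (nsolve 3 (λ n k t →
    (n ⊗ (ncon 1 ⊕ k) ⊕ t) ⊕ (ncon 1 ⊕ k) ⊜ (ncon 1 ⊕ n) ⊗ (ncon 1 ⊕ k) ⊕ t)
    ≡.refl n k (T (2 ℕ.+ k))))
  x₂ : X e * (X (suc m ℕ.+ (2 ℕ.+ k)) * X (suc k)) ≈ X (suc n) * X e₂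
  x₂ = R.trans (*-congˡ (X e) (R.sym (X-+ (suc m ℕ.+ (2 ℕ.+ k)) (suc k))))
    (R.trans (R.sym (X-+ e (suc m ℕ.+ (2 ℕ.+ k) ℕ.+ suc k)))
    (R.trans (X-≡ (nsolve 3 (λ n k t →
      (n ⊗ (ncon 1 ⊕ k) ⊕ t) ⊕ ((ncon 2 ⊕ n ⊗ ncon 2) ⊕ (ncon 2 ⊕ k) ⊕ (ncon 1 ⊕ k))
      ⊜ (ncon 1 ⊕ n) ⊕ ((ncon 1 ⊕ n) ⊗ (ncon 2 ⊕ k) ⊕ ((ncon 2 ⊕ k) ⊕ t)))
      ≡.refl n k (T (2 ℕ.+ k))))
    (X-+ (suc n) e₂)))

-- The case k = 0 of the same comparison: the neighbour at k = -1 equals the one at k = 1 by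
-- `Y-reflect`, hence the doubled term.
v-base : ∀ n → v n 0 ≈
  (1# + X (2 ℕ.+ n ℕ.* 2)) * v (suc n) 0 + (X (suc n) * v (suc n) 1 + X (suc n) * v (suc n) 1)
v-base n = begin
  v n 0
    ≈⟨ v-zero n ⟩
  Y m 1
    ≈⟨ Y-step m 0 ⟩
  Y (2 ℕ.+ m) 0 + (1# + u) * 1# * y₁ + X (suc m ℕ.+ 1) * 1# * y₂
    ≈⟨ R.+-cong (+-congʳ ((1# + u) * 1# * y₁) (Y-reflect (suc m)))
         (*-congʳ y₂ (*-congʳ 1# (X-≡ (ℕ.+-comm (suc m) 1)))) ⟩
  X (2 ℕ.+ m) * y₂ + (1# + u) * 1# * y₁ + X (2 ℕ.+ m) * 1# * y₂
    ≈⟨ solve 4 (λ x u y₁ y₂ → x :* y₂ :+ (con 1ℤ :+ u) :* con 1ℤ :* y₁ :+ x :* con 1ℤ :* y₂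
         := (con 1ℤ :+ u) :* y₁ :+ (x :* y₂ :+ x :* y₂)) (λ _ → ≡.refl) (X (2 ℕ.+ m)) u y₁ y₂ ⟩
  (1# + u) * y₁ + (X (2 ℕ.+ m) * y₂ + X (2 ℕ.+ m) * y₂)
    ≈⟨ R.+-cong (*-congˡ (1# + u) (R.sym (v-zero (suc n)))) (R.+-cong v1 v1) ⟩
  (1# + u) * v (suc n) 0 + (X (suc n) * v (suc n) 1 + X (suc n) * v (suc n) 1) ∎
  where
  m : ℕ
  m = suc (n ℕ.* 2)
  u y₁ y₂ : FPS
  u  = X (2 ℕ.+ n ℕ.* 2)
  y₁ = Y (2 ℕ.+ m) 1
  y₂ = Y (2 ℕ.+ m) 2
  v1 : X (2 ℕ.+ m) * y₂ ≈ X (suc n) * v (suc n) 1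
  v1 = R.trans (*-congʳ y₂ (R.trans (X-≡ (ℕS.solve 1 (λ n →
      ℕS.con 3 ℕS.:+ n ℕS.:* ℕS.con 2
      ℕS.:= (ℕS.con 1 ℕS.:+ n) ℕS.:+ ((ℕS.con 1 ℕS.:+ n) ℕS.:* ℕS.con 1 ℕS.:+ ℕS.con 1)) ≡.refl n))
      (X-+ (suc n) (suc n ℕ.* 1 ℕ.+ 1))))
    (R.*-assoc (X (suc n)) (X (suc n ℕ.* 1 ℕ.+ 1)) y₂)

-- At z = -1 the factor (1 - zqⁿ⁺¹)(1 - z⁻¹qⁿ⁺¹) is (1 + qⁿ⁺¹)². The two-sided sum over k is folded
-- onto k ≥ 0, so the shifts by one in either direction are accounted for by `Sum-head`.
W-step : ∀ n → W n ≈ (1# + X (suc n)) * (1# + X (suc n)) * W (suc n)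
W-step n = begin
  v n 0 + (S + S)
    ≈⟨ R.+-cong (v-base n) (R.+-cong S≈ S≈) ⟩
  ((1# + u) * w 0 + (x * w 1 + x * w 1))
    + (((1# + u) * S₁ + x * ((w 0 + S₁) + S₂)) + ((1# + u) * S₁ + x * ((w 0 + S₁) + S₂)))
    ≈⟨ solve 6 (λ u x a b s₁ s₂ →
         ((con 1ℤ :+ u) :* a :+ (x :* b :+ x :* b))
         :+ (((con 1ℤ :+ u) :* s₁ :+ x :* ((a :+ s₁) :+ s₂)) :+ ((con 1ℤ :+ u) :* s₁ :+ x :* ((a :+ s₁) :+ s₂)))
         := (con 1ℤ :+ u) :* (a :+ (s₁ :+ s₁))
            :+ (x :+ x) :* (a :+ (s₁ :+ (b :+ s₂))))
         (λ _ → ≡.refl) u x (w 0) (w 1) S₁ S₂ ⟩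
  (1# + u) * W (suc n) + (x + x) * (w 0 + (S₁ + (w 1 + S₂)))
    ≈⟨ +-congˡ ((1# + u) * W (suc n)) (*-congˡ (x + x) (+-congˡ (w 0) (+-congˡ S₁
         (R.sym (Sum-head (vanishing-suc (v-vanishing (suc n)))))))) ⟩
  (1# + u) * W (suc n) + (x + x) * W (suc n)
    ≈⟨ +-congʳ ((x + x) * W (suc n)) (*-congʳ (W (suc n)) (+-congˡ 1# u≈)) ⟩
  (1# + x * x) * W (suc n) + (x + x) * W (suc n)
    ≈⟨ solve 2 (λ x a → (con 1ℤ :+ x :* x) :* a :+ (x :+ x) :* a
         := (con 1ℤ :+ x) :* (con 1ℤ :+ x) :* a) (λ _ → ≡.refl) x (W (suc n)) ⟩
  (1# + x) * (1# + x) * W (suc n) ∎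
  where
  w : ℕ → FPS
  w = v (suc n)
  x u S S₁ S₂ : FPS
  x  = X (suc n)
  u  = X (2 ℕ.+ n ℕ.* 2)
  S  = Sum (v n ∘ suc)
  S₁ = Sum (w ∘ suc)
  S₂ = Sum (w ∘ suc ∘ suc)
  u≈ : u ≈ x * x
  u≈ = R.trans (X-≡ (ℕS.solve 1 (λ n → ℕS.con 2 ℕS.:+ n ℕS.:* ℕS.con 2
    ℕS.:= (ℕS.con 1 ℕS.:+ n) ℕS.:+ (ℕS.con 1 ℕS.:+ n)) ≡.refl n)) (X-+ (suc n) (suc n))
  w₀₂-vanishing : Vanishing (λ k → w k + w (2 ℕ.+ k))
  w₀₂-vanishing = vanishing-+ (v-vanishing (suc n)) (vanishing-suc (vanishing-suc (v-vanishing (suc n))))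
  S≈ : S ≈ (1# + u) * S₁ + x * ((w 0 + S₁) + S₂)
  S≈ = begin
    S
      ≈⟨ Sum-cong (v-step n) ⟩
    Sum (λ k → (1# + u) * w (suc k) + x * (w k + w (2 ℕ.+ k)))
      ≈⟨ Sum-+ (λ k → (1# + u) * w (suc k)) (λ k → x * (w k + w (2 ℕ.+ k))) ⟩
    Sum (λ k → (1# + u) * w (suc k)) + Sum (λ k → x * (w k + w (2 ℕ.+ k)))
      ≈⟨ R.+-cong (Sum-* (1# + u) (vanishing-suc (v-vanishing (suc n)))) (Sum-* x w₀₂-vanishing) ⟨
    (1# + u) * S₁ + x * Sum (λ k → w k + w (2 ℕ.+ k))
      ≈⟨ +-congˡ ((1# + u) * S₁) (*-congˡ x (R.trans (Sum-+ w (w ∘ suc ∘ suc))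
           (+-congʳ S₂ (Sum-head (v-vanishing (suc n)))))) ⟩
    (1# + u) * S₁ + x * ((w 0 + S₁) + S₂) ∎

triangular-exponent : ∀ n → n ℕ.* (n ℕ.+ 1) / 2 ≡ T (suc n)
triangular-exponent n = ≡.trans (≡.cong (_/ 2) (double n)) (m*n/n≡m (T (suc n)) 2)
  where
  double : ∀ n → n ℕ.* (n ℕ.+ 1) ≡ T (suc n) ℕ.* 2
  double zero    = ≡.refl
  double (suc n) = ≡.trans
    (ℕS.solve 1 (λ n → (ℕS.con 1 ℕS.:+ n) ℕS.:* (ℕS.con 1 ℕS.:+ n ℕS.:+ ℕS.con 1)
      ℕS.:= (ℕS.con 1 ℕS.:+ n) ℕS.:* ℕS.con 2 ℕS.:+ n ℕS.:* (n ℕS.:+ ℕS.con 1)) ≡.refl n)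
    (≡.trans (≡.cong (suc n ℕ.* 2 ℕ.+_) (double n)) (≡.sym (ℕ.*-distribʳ-+ 2 (suc n) (T (suc n)))))

triangularSum≈Sum : triangularSum ≈ Sum (X ∘ T ∘ suc)
triangularSum≈Sum = R.trans
  (∑∞≈Sum (vanishing-cong (λ n → R.sym (term n)) X-vanishing) triangular-summable) (Sum-cong term)
  where
  term : ∀ n → triangularTerm n ≈ X (T (suc n))
  term n = X-≡ (triangular-exponent n)
  X-vanishing : Vanishing (X ∘ T ∘ suc)
  X-vanishing = order⇒vanishing (T ∘ suc) (λ n → n≤1+2e (ℕ.m≤m+n n (T n)))
    (λ n → order-^ q ≡.refl (T (suc n)))

-- `Y-recʳ` at m = 0 expands the constant `Y 0 s` = 1, and so writes each triangular power as the
-- sum of two neighbours `v 0 k` and `v 0 (suc k)`. Summing over k counts `v 0 0` once and every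
-- later `v 0 k` twice, as in `W 0`.
triangularSum≈W0 : triangularSum ≈ W 0
triangularSum≈W0 = begin
  triangularSum                                   ≈⟨ triangularSum≈Sum ⟩
  Sum (X ∘ T ∘ suc)                               ≈⟨ Sum-cong pair ⟩
  Sum (λ k → v 0 k + v 0 (suc k))                 ≈⟨ Sum-+ (v 0) (v 0 ∘ suc) ⟩
  Sum (v 0) + Sum (v 0 ∘ suc)                     ≈⟨ +-congʳ (Sum (v 0 ∘ suc)) (Sum-head (v-vanishing 0)) ⟩
  (v 0 0 + Sum (v 0 ∘ suc)) + Sum (v 0 ∘ suc)     ≈⟨ R.+-assoc (v 0 0) _ _ ⟩
  W 0                                             ∎
  where
  pair : ∀ k → X (T (suc k)) ≈ v 0 k + v 0 (suc k)
  pair k = begin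
    t                                       ≈⟨ R.*-identityʳ t ⟨
    t * 1#                                  ≈⟨ *-congˡ t (R.trans (R.sym (Y-zero (2 ℕ.+ k))) (Y-recʳ 0 (suc k))) ⟩
    t * (Y 1 (suc k) + X (suc k) * Y 1 (2 ℕ.+ k))
      ≈⟨ solve 4 (λ t a x b → t :* (a :+ x :* b) := t :* a :+ x :* t :* b) (λ _ → ≡.refl)
           t (Y 1 (suc k)) (X (suc k)) (Y 1 (2 ℕ.+ k)) ⟩
    v 0 k + X (suc k) * t * Y 1 (2 ℕ.+ k)
      ≈⟨ +-congˡ (v 0 k) (*-congʳ (Y 1 (2 ℕ.+ k)) (X-+ (suc k) (T (suc k)))) ⟨
    v 0 k + v 0 (suc k) ∎
    where
    t : FPS
    t = X (T (suc k))

triangularSum≈D*W : ∀ n → triangularSum ≈ mockThetaDenominator n * W n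
triangularSum≈D*W zero = R.trans triangularSum≈W0
  (solve 1 (λ w → w := con 1ℤ :* (con 1ℤ :* con 1ℤ) :* w) (λ _ → ≡.refl) (W 0))
triangularSum≈D*W (suc n) = begin
  triangularSum
    ≈⟨ triangularSum≈D*W n ⟩
  p * (p * 1#) * W n
    ≈⟨ *-congˡ (p * (p * 1#)) (W-step n) ⟩
  p * (p * 1#) * ((1# + q * x) * (1# + q * x) * W (suc n))
    ≈⟨ solve 3 (λ p z w → p :* (p :* con 1ℤ) :* (z :* z :* w) := z :* p :* (z :* p :* con 1ℤ) :* w)
         (λ _ → ≡.refl) p (1# + q * x) (W (suc n)) ⟩
  (1# + q * x) * p * ((1# + q * x) * p * 1#) * W (suc n)
    ≈⟨ *-congʳ (W (suc n)) (*-cong factor (*-congʳ 1# factor)) ⟩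
  mockThetaDenominator (suc n) * W (suc n) ∎
  where
  p x : FPS
  p = poch (- q) q n
  x = X n
  factor : (1# + q * x) * p ≈ poch (- q) q (suc n)
  factor = *-congʳ p (solve 2 (λ q x → con 1ℤ :+ q :* x := con 1ℤ :- (:- q) :* x) (λ _ → ≡.refl) q x)

n≤n*n : ∀ n → n ≤ n ℕ.* n
n≤n*n zero    = z≤n
n≤n*n (suc n) = ℕ.m≤m*n (suc n) (suc n)

ψ*f : triangularSum * mockThetaF ≈ Sum (λ n → X (n ℕ.* n) * W n)
ψ*f = begin
  triangularSum * mockThetaF
    ≈⟨ *-congˡ triangularSum (∑∞≈Sum term-vanishing mockTheta-summable) ⟩
  triangularSum * Sum mockThetaTerm
    ≈⟨ Sum-* triangularSum term-vanishing ⟩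
  Sum (λ n → triangularSum * mockThetaTerm n)
    ≈⟨ Sum-cong term ⟩
  Sum (λ n → X (n ℕ.* n) * W n) ∎
  where
  r : ℕ → FPS
  r n = recip (mockThetaDenominator n) (mockThetaDenominator-const n)
  term-vanishing : Vanishing mockThetaTerm
  term-vanishing = X*-vanishing (λ n → n ℕ.* n) (λ n → n≤1+2e (n≤n*n n)) r
  term : ∀ n → triangularSum * mockThetaTerm n ≈ X (n ℕ.* n) * W n
  term n = begin
    triangularSum * (x * r n)
      ≈⟨ *-congʳ (x * r n) (triangularSum≈D*W n) ⟩
    d * W n * (x * r n)
      ≈⟨ solve 4 (λ d w x r → d :* w :* (x :* r) := x :* w :* (d :* r)) (λ _ → ≡.refl) d (W n) x (r n) ⟩
    x * W n * (d * r n)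
      ≈⟨ *-congˡ (x * W n) (*-recip d (mockThetaDenominator-const n)) ⟩
    x * W n * 1#
      ≈⟨ R.*-identityʳ (x * W n) ⟩
    x * W n ∎
    where
    x d : FPS
    x = X (n ℕ.* n)
    d = mockThetaDenominator n

-- The functional equation of Z

n≤n²+ : ∀ {n} m → n ≤ suc (2 ℕ.* (n ℕ.* n ℕ.+ m))
n≤n²+ {n} m = n≤1+2e (ℕ.≤-trans (n≤n*n n) (ℕ.m≤m+n (n ℕ.* n) m))

-- Z₁ s = Z(qˢ), while Z₂ uses the even first arguments of Y; each is expressed
-- through the other at s + 1.
Z₁Term Z₂Term : ℕ → ℕ → FPS
Z₁Term s n = X (n ℕ.* n ℕ.+ n ℕ.* s) * Y (suc (n ℕ.* 2)) (suc s)
Z₂Term s n = X (n ℕ.* n ℕ.+ (n ℕ.+ n ℕ.* s)) * Y (2 ℕ.+ n ℕ.* 2) (suc s)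

Z₁ Z₂ : ℕ → FPS
Z₁ s = Sum (Z₁Term s)
Z₂ s = Sum (Z₂Term s)

Z₁Term-vanishing : ∀ s → Vanishing (Z₁Term s)
Z₁Term-vanishing s = X*-vanishing (λ n → n ℕ.* n ℕ.+ n ℕ.* s) (λ n → n≤n²+ (n ℕ.* s))
  (λ n → Y (suc (n ℕ.* 2)) (suc s))

Z₂Term-vanishing : ∀ s → Vanishing (Z₂Term s)
Z₂Term-vanishing s = X*-vanishing (λ n → n ℕ.* n ℕ.+ (n ℕ.+ n ℕ.* s)) (λ n → n≤n²+ (n ℕ.+ n ℕ.* s))
  (λ n → Y (2 ℕ.+ n ℕ.* 2) (suc s))

private
  -- `Y-recˡ` splits `g n` into a term of the wanted series and a rest, `Y-recʳ` splits the rest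
  -- into `g (suc n)` and a term of the other series, and summation over n cancels every `g` except
  -- `g 0`. The weight q^{n²} is what makes this fit: the increment of the exponent of `g` from n to
  -- n + 1 is exactly the power of q produced by `Y-recˡ`.
  Sum-shift : ∀ {g z r w : ℕ → FPS} a → Vanishing g → Vanishing w →
    (∀ n → g n ≈ z n + r n) → (∀ n → r n ≈ g (suc n) + a * w n) → g 0 ≈ Sum z + a * Sum w
  Sum-shift {g} {z} {r} {w} a vg vw g≈ r≈ = begin
    g 0                       ≈⟨ solve 2 (λ x y → x := (x :+ y) :- y) (λ _ → ≡.refl) (g 0) S ⟩
    (g 0 + S) - S             ≈⟨ +-congʳ (- S) (Sum-head vg) ⟨
    Sum g - S                 ≈⟨ +-congʳ (- S) (R.trans (Sum-cong g≈) (Sum-+ z r)) ⟩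
    (Sum z + Sum r) - S       ≈⟨ +-congʳ (- S) (+-congˡ (Sum z) (R.trans (Sum-cong r≈)
                                   (R.trans (Sum-+ (g ∘ suc) (λ n → a * w n)) (+-congˡ S (R.sym (Sum-* a vw)))))) ⟩
    (Sum z + (S + a * Sum w)) - S
      ≈⟨ solve 3 (λ x y u → (x :+ (y :+ u)) :- y := x :+ u) (λ _ → ≡.refl) (Sum z) S (a * Sum w) ⟩
    Sum z + a * Sum w         ∎
    where
    S : FPS
    S = Sum (g ∘ suc)

Z₁-rec : ∀ s → 1# ≈ Z₁ s + X (suc s ℕ.+ suc s) * Z₂ (suc s)
Z₁-rec s = R.trans (R.sym g0) (Sum-shift (X (suc s ℕ.+ suc s)) vg (Z₂Term-vanishing (suc s)) g≈ r≈)
  where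
  e : ℕ → ℕ
  e n = n ℕ.* n ℕ.+ n ℕ.* s
  g r : ℕ → FPS
  g n = X (e n) * Y (n ℕ.* 2) (suc s)
  r n = X (e n) * (X (n ℕ.* 2 ℕ.+ suc s) * Y (suc (n ℕ.* 2)) (2 ℕ.+ s))
  vg : Vanishing g
  vg = X*-vanishing e (λ n → n≤n²+ (n ℕ.* s)) (λ n → Y (n ℕ.* 2) (suc s))
  g0 : g 0 ≈ 1#
  g0 = R.trans (R.*-identityˡ (Y 0 (suc s))) (Y-zero (suc s))
  g≈ : ∀ n → g n ≈ Z₁Term s n + r n
  g≈ n = R.trans (*-congˡ (X (e n)) (Y-recˡ (n ℕ.* 2) (suc s)))
    (R.distribˡ (X (e n)) (Y (suc (n ℕ.* 2)) (suc s)) (X (n ℕ.* 2 ℕ.+ suc s) * Y (suc (n ℕ.* 2)) (2 ℕ.+ s)))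
  r≈ : ∀ n → r n ≈ g (suc n) + X (suc s ℕ.+ suc s) * Z₂Term (suc s) n
  r≈ n = begin
    X (e n) * (X (m ℕ.+ suc s) * Y (suc m) (2 ℕ.+ s))
      ≈⟨ R.trans (R.sym (R.*-assoc (X (e n)) (X (m ℕ.+ suc s)) (Y (suc m) (2 ℕ.+ s))))
           (*-cong (R.trans (R.sym (X-+ (e n) (m ℕ.+ suc s))) (X-≡ (nsolve 2 (λ n s →
             n ⊗ n ⊕ n ⊗ s ⊕ (n ⊗ ncon 2 ⊕ (ncon 1 ⊕ s))
             ⊜ (ncon 1 ⊕ n) ⊗ (ncon 1 ⊕ n) ⊕ (ncon 1 ⊕ n) ⊗ s) ≡.refl n s)))
             (Y-recʳ (suc m) (suc s))) ⟩
    x * (Y (2 ℕ.+ m) (suc s) + X (suc s) * y)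
      ≈⟨ solve 4 (λ x a z y → x :* (a :+ z :* y) := x :* a :+ x :* z :* y) (λ _ → ≡.refl)
           x (Y (2 ℕ.+ m) (suc s)) (X (suc s)) y ⟩
    g (suc n) + x * X (suc s) * y
      ≈⟨ +-congˡ (g (suc n)) (*-congʳ y (R.trans (R.sym (X-+ (e (suc n)) (suc s)))
           (R.trans (X-≡ (nsolve 2 (λ n s →
             (ncon 1 ⊕ n) ⊗ (ncon 1 ⊕ n) ⊕ (ncon 1 ⊕ n) ⊗ s ⊕ (ncon 1 ⊕ s)
             ⊜ (ncon 1 ⊕ s) ⊕ (ncon 1 ⊕ s) ⊕ (n ⊗ n ⊕ (n ⊕ n ⊗ (ncon 1 ⊕ s)))) ≡.refl n s))
           (X-+ (suc s ℕ.+ suc s) e₂)))) ⟩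
    g (suc n) + X (suc s ℕ.+ suc s) * X e₂ * y
      ≈⟨ +-congˡ (g (suc n)) (R.*-assoc (X (suc s ℕ.+ suc s)) (X e₂) y) ⟩
    g (suc n) + X (suc s ℕ.+ suc s) * Z₂Term (suc s) n ∎
    where
    m e₂ : ℕ
    m = n ℕ.* 2
    e₂ = n ℕ.* n ℕ.+ (n ℕ.+ n ℕ.* suc s)
    x y : FPS
    x = X (e (suc n))
    y = Y (2 ℕ.+ m) (2 ℕ.+ s)

Z₂-rec : ∀ s → 1# ≈ Z₂ s + X (suc s) * Z₁ (suc s)
Z₂-rec s = begin
  1#
    ≈⟨ Y-zero (2 ℕ.+ s) ⟨
  Y 0 (2 ℕ.+ s)
    ≈⟨ Y-recʳ 0 (suc s) ⟩
  Y 1 (suc s) + X (suc s) * Y 1 (2 ℕ.+ s)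
    -- Here `g 0` is `Y 1 (suc s)` rather than 1, and the shifted sum of `Z₁Term (suc s)` starts at
    -- n = 1. The second summand in the expansion of 1 supplies precisely the missing term at n = 0.
    ≈⟨ +-congʳ (X (suc s) * Y 1 (2 ℕ.+ s)) (R.trans (R.sym (R.*-identityˡ (Y 1 (suc s))))
         (Sum-shift (X (suc s)) vg (vanishing-suc (Z₁Term-vanishing (suc s))) g≈ r≈)) ⟩
  (Z₂ s + X (suc s) * Sum (Z₁Term (suc s) ∘ suc)) + X (suc s) * Y 1 (2 ℕ.+ s)
    ≈⟨ solve 4 (λ z x a y → (z :+ x :* a) :+ x :* y := z :+ x :* (con 1ℤ :* y :+ a)) (λ _ → ≡.refl)
         (Z₂ s) (X (suc s)) (Sum (Z₁Term (suc s) ∘ suc)) (Y 1 (2 ℕ.+ s)) ⟩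
  Z₂ s + X (suc s) * (Z₁Term (suc s) 0 + Sum (Z₁Term (suc s) ∘ suc))
    ≈⟨ +-congˡ (Z₂ s) (*-congˡ (X (suc s)) (Sum-head (Z₁Term-vanishing (suc s)))) ⟨
  Z₂ s + X (suc s) * Z₁ (suc s) ∎
  where
  e : ℕ → ℕ
  e n = n ℕ.* n ℕ.+ (n ℕ.+ n ℕ.* s)
  g r : ℕ → FPS
  g n = X (e n) * Y (suc (n ℕ.* 2)) (suc s)
  r n = X (e n) * (X (suc (n ℕ.* 2) ℕ.+ suc s) * Y (2 ℕ.+ n ℕ.* 2) (2 ℕ.+ s))
  vg : Vanishing g
  vg = X*-vanishing e (λ n → n≤n²+ (n ℕ.+ n ℕ.* s)) (λ n → Y (suc (n ℕ.* 2)) (suc s))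
  g≈ : ∀ n → g n ≈ Z₂Term s n + r n
  g≈ n = R.trans (*-congˡ (X (e n)) (Y-recˡ (suc (n ℕ.* 2)) (suc s)))
    (R.distribˡ (X (e n)) (Y (2 ℕ.+ n ℕ.* 2) (suc s))
      (X (suc (n ℕ.* 2) ℕ.+ suc s) * Y (2 ℕ.+ n ℕ.* 2) (2 ℕ.+ s)))
  r≈ : ∀ n → r n ≈ g (suc n) + X (suc s) * Z₁Term (suc s) (suc n)
  r≈ n = begin
    X (e n) * (X (m ℕ.+ suc s) * Y (suc m) (2 ℕ.+ s))
      ≈⟨ R.trans (R.sym (R.*-assoc (X (e n)) (X (m ℕ.+ suc s)) (Y (suc m) (2 ℕ.+ s))))
           (*-cong (R.trans (R.sym (X-+ (e n) (m ℕ.+ suc s))) (X-≡ (nsolve 2 (λ n s →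
             n ⊗ n ⊕ (n ⊕ n ⊗ s) ⊕ (ncon 1 ⊕ n ⊗ ncon 2 ⊕ (ncon 1 ⊕ s))
             ⊜ (ncon 1 ⊕ n) ⊗ (ncon 1 ⊕ n) ⊕ ((ncon 1 ⊕ n) ⊕ (ncon 1 ⊕ n) ⊗ s)) ≡.refl n s)))
             (Y-recʳ (suc m) (suc s))) ⟩
    x * (Y (2 ℕ.+ m) (suc s) + X (suc s) * y)
      ≈⟨ solve 4 (λ x a z y → x :* (a :+ z :* y) := x :* a :+ z :* (x :* y)) (λ _ → ≡.refl)
           x (Y (2 ℕ.+ m) (suc s)) (X (suc s)) y ⟩
    g (suc n) + X (suc s) * (x * y)
      ≈⟨ +-congˡ (g (suc n)) (*-congˡ (X (suc s)) (*-congʳ y (X-≡ (nsolve 2 (λ n s →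
           (ncon 1 ⊕ n) ⊗ (ncon 1 ⊕ n) ⊕ ((ncon 1 ⊕ n) ⊕ (ncon 1 ⊕ n) ⊗ s)
           ⊜ (ncon 1 ⊕ n) ⊗ (ncon 1 ⊕ n) ⊕ (ncon 1 ⊕ n) ⊗ (ncon 1 ⊕ s)) ≡.refl n s)))) ⟩
    g (suc n) + X (suc s) * Z₁Term (suc s) (suc n) ∎
    where
    m : ℕ
    m = suc (n ℕ.* 2)
    x y : FPS
    x = X (e (suc n))
    y = Y (2 ℕ.+ m) (2 ℕ.+ s)

Z₁-step : ∀ s → Z₁ s ≈ (1# - X (suc s ℕ.+ suc s)) + X (suc s ℕ.+ suc s) * X (2 ℕ.+ s) * Z₁ (2 ℕ.+ s)
Z₁-step s = begin
  Z₁ s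
    ≈⟨ solve 3 (λ a u b → a := (a :+ u :* b) :- u :* b) (λ _ → ≡.refl) (Z₁ s) u (Z₂ (suc s)) ⟩
  (Z₁ s + u * Z₂ (suc s)) - u * Z₂ (suc s)
    ≈⟨ +-congʳ (- (u * Z₂ (suc s))) (Z₁-rec s) ⟨
  1# - u * Z₂ (suc s)
    ≈⟨ solve 4 (λ u z x y → con 1ℤ :- u :* z := (con 1ℤ :- u :* (z :+ x :* y)) :+ u :* x :* y) (λ _ → ≡.refl)
         u (Z₂ (suc s)) (X (2 ℕ.+ s)) (Z₁ (2 ℕ.+ s)) ⟩
  (1# - u * (Z₂ (suc s) + X (2 ℕ.+ s) * Z₁ (2 ℕ.+ s))) + u * X (2 ℕ.+ s) * Z₁ (2 ℕ.+ s)
    ≈⟨ +-congʳ (u * X (2 ℕ.+ s) * Z₁ (2 ℕ.+ s))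
         (+-congˡ 1# (R.-‿cong (R.trans (*-congˡ u (R.sym (Z₂-rec (suc s)))) (R.*-identityʳ u)))) ⟩
  (1# - u) + u * X (2 ℕ.+ s) * Z₁ (2 ℕ.+ s) ∎
  where
  u : FPS
  u = X (suc s ℕ.+ suc s)

-- Summation along the diagonals of a symmetric double series

-- The Hecke terms of m and of -(m+1), taken at the same d = n - 2|m| and hence at different n.
-- Unlike the pairing of m with -m, this one is symmetric in m and d.
h : ℕ → ℕ → FPS
h m d = X (E m d) * (1# - X (E₂ m d))

m≤E : ∀ m d → m ≤ E m d
m≤E m d = ℕ.≤-trans (ℕ.m≤m+n m (T m)) (ℕ.≤-trans (ℕ.m≤m+n _ _) (ℕ.m≤m+n _ (T (suc d))))

d≤E : ∀ m d → d ≤ E m d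
d≤E m d = ℕ.≤-trans (ℕ.m≤m+n d (T d)) (ℕ.m≤n+m _ (T (suc m) ℕ.+ 2 ℕ.* (m ℕ.* d)))

diagonal : ℕ → FPS
diagonal k = Sum (λ m → h m (m ℕ.+ k))

-- Iteration of `Z₁-step` from s = k. At s = 2i + k the step contributes the factor q^{3s+4}, which
-- is the increment from `E i (i ℕ.+ k)` to `E (suc i) (suc i ℕ.+ k)`, and the starting value
-- `E 0 k` is `T (suc k)`.
Z₁-diagonal : ∀ k → X (T (suc k)) * Z₁ k ≈ diagonal k
Z₁-diagonal k = Sum-telescope {L} step
  (X*-vanishing (λ i → E i (i ℕ.+ k)) (λ i → n≤1+2e (m≤E i (i ℕ.+ k))) (λ i → Z₁ (i ℕ.* 2 ℕ.+ k)))
  where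
  L : ℕ → FPS
  L i = X (E i (i ℕ.+ k)) * Z₁ (i ℕ.* 2 ℕ.+ k)
  step : ∀ i → L i ≈ h i (i ℕ.+ k) + L (suc i)
  step i = begin
    x * Z₁ s
      ≈⟨ *-congˡ x (Z₁-step s) ⟩
    x * ((1# - u) + u * X (2 ℕ.+ s) * z)
      ≈⟨ solve 4 (λ x u w z → x :* ((con 1ℤ :- u) :+ u :* w :* z) := x :* (con 1ℤ :- u) :+ x :* (u :* w) :* z)
           (λ _ → ≡.refl) x u (X (2 ℕ.+ s)) z ⟩
    x * (1# - u) + x * (u * X (2 ℕ.+ s)) * z
      ≈⟨ R.+-cong (*-congˡ x (+-congˡ 1# (R.-‿cong (X-≡ (nsolve 2 (λ i k →
           (ncon 1 ⊕ (i ⊗ ncon 2 ⊕ k)) ⊕ (ncon 1 ⊕ (i ⊗ ncon 2 ⊕ k))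
           ⊜ (ncon 1 ⊕ (i ⊕ (i ⊕ k))) ⊕ (ncon 1 ⊕ (i ⊕ (i ⊕ k)))) ≡.refl i k)))))
         (*-congʳ z x′) ⟩
    h i (i ℕ.+ k) + L (suc i) ∎
    where
    s : ℕ
    s = i ℕ.* 2 ℕ.+ k
    x u z : FPS
    x = X (E i (i ℕ.+ k))
    u = X (suc s ℕ.+ suc s)
    z = Z₁ (2 ℕ.+ s)
    x′ : x * (u * X (2 ℕ.+ s)) ≈ X (E (suc i) (suc i ℕ.+ k))
    x′ = R.trans (*-congˡ x (R.sym (X-+ (suc s ℕ.+ suc s) (2 ℕ.+ s))))
      (R.trans (R.sym (X-+ (E i (i ℕ.+ k)) (suc s ℕ.+ suc s ℕ.+ (2 ℕ.+ s))))
      (X-≡ (nsolve 4 (λ i k t t′ →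
        (t ⊕ ncon 2 ⊗ (i ⊗ (i ⊕ k)) ⊕ t′)
          ⊕ ((ncon 1 ⊕ (i ⊗ ncon 2 ⊕ k)) ⊕ (ncon 1 ⊕ (i ⊗ ncon 2 ⊕ k)) ⊕ (ncon 2 ⊕ (i ⊗ ncon 2 ⊕ k)))
        ⊜ ((ncon 1 ⊕ i) ⊕ t) ⊕ ncon 2 ⊗ ((ncon 1 ⊕ i) ⊗ (ncon 1 ⊕ i ⊕ k)) ⊕ ((ncon 1 ⊕ i ⊕ k) ⊕ t′))
        ≡.refl i k (T (suc i)) (T (suc (i ℕ.+ k))))))

-- Summing over n before k turns the k-th column ∑ₙ q^{n²} `v n k` into q^{k(k+1)/2} Z(q^k), which
-- `Z₁-diagonal` evaluates.
ψ*f≈diagonals : triangularSum * mockThetaF ≈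
  diagonal 0 + (Sum (diagonal ∘ suc) + Sum (diagonal ∘ suc))
ψ*f≈diagonals = begin
  triangularSum * mockThetaF
    ≈⟨ ψ*f ⟩
  Sum (λ n → x n * W n)
    ≈⟨ Sum-cong expand ⟩
  Sum (λ n → x n * v n 0 + (xS n + xS n))
    ≈⟨ R.trans (Sum-+ (λ n → x n * v n 0) (λ n → xS n + xS n))
           (+-congˡ (Sum (λ n → x n * v n 0)) (Sum-+ xS xS)) ⟩
  Sum (λ n → x n * v n 0) + (Sum xS + Sum xS)
    ≈⟨ R.+-cong (column 0) (R.+-cong rows rows) ⟩
  diagonal 0 + (Sum (diagonal ∘ suc) + Sum (diagonal ∘ suc)) ∎
  where
  x xS : ℕ → FPS
  x n = X (n ℕ.* n)
  xS n = Sum (λ k → x n * v n (suc k))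
  expand : ∀ n → x n * W n ≈ x n * v n 0 + (xS n + xS n)
  expand n = R.trans
    (solve 3 (λ x a b → x :* (a :+ (b :+ b)) := x :* a :+ (x :* b :+ x :* b)) (λ _ → ≡.refl)
      (x n) (v n 0) (Sum (v n ∘ suc)))
    (+-congˡ (x n * v n 0) (R.+-cong x*Sum x*Sum))
    where
    x*Sum : x n * Sum (v n ∘ suc) ≈ xS n
    x*Sum = Sum-* (x n) (vanishing-suc (v-vanishing n))
  column : ∀ k → Sum (λ n → x n * v n k) ≈ diagonal k
  column k = R.trans (R.trans (Sum-cong term) (R.sym (Sum-* t (Z₁Term-vanishing k)))) (Z₁-diagonal k)
    where
    t : FPS
    t = X (T (suc k))
    term : ∀ n → x n * v n k ≈ t * Z₁Term k n
    term n = begin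
      x n * (X (n ℕ.* k ℕ.+ T (suc k)) * y)     ≈⟨ *-congˡ (x n) (*-congʳ y (X-+ (n ℕ.* k) (T (suc k)))) ⟩
      x n * (X (n ℕ.* k) * t * y)
        ≈⟨ solve 4 (λ x z t y → x :* (z :* t :* y) := t :* (x :* z :* y)) (λ _ → ≡.refl) (x n) (X (n ℕ.* k)) t y ⟩
      t * (x n * X (n ℕ.* k) * y)               ≈⟨ *-congˡ t (*-congʳ y (X-+ (n ℕ.* n) (n ℕ.* k))) ⟨
      t * Z₁Term k n                            ∎
      where
      y : FPS
      y = Y (suc (n ℕ.* 2)) (suc k)
  rows : Sum xS ≈ Sum (diagonal ∘ suc)
  rows = R.trans (Sum-swap (λ n k → x n * v n (suc k))) (Sum-cong (column ∘ suc))

h-sym : ∀ m d → h m d ≈ h d m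
h-sym m d = *-cong
  (X-≡ (nsolve 4 (λ m d t t′ → t ⊕ ncon 2 ⊗ (m ⊗ d) ⊕ t′ ⊜ t′ ⊕ ncon 2 ⊗ (d ⊗ m) ⊕ t)
    ≡.refl m d (T (suc m)) (T (suc d))))
  (+-congˡ 1# (R.-‿cong (X-≡ (≡.cong (λ n → suc n ℕ.+ suc n) (ℕ.+-comm m d)))))

h-≡ : ∀ {m m′ d d′} → m ≡ m′ → d ≡ d′ → h m d ≈ h m′ d′
h-≡ ≡.refl ≡.refl _ = ≡.refl

-- `L i` is the sum over the quadrant m, d ≥ i. Peeling off its corner hook leaves `L (suc i)`; the
-- two arms of the hook agree by `h-sym`. Summing corners and arms over i collects the diagonals.
square≈diagonals : Sum (λ m → Sum (h m)) ≈ diagonal 0 + (Sum (diagonal ∘ suc) + Sum (diagonal ∘ suc))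
square≈diagonals = begin
  L 0
    ≈⟨ Sum-telescope step L-vanishing ⟩
  Sum (λ i → h i (i ℕ.+ 0) + (ray i + ray i))
    ≈⟨ R.trans (Sum-+ (λ i → h i (i ℕ.+ 0)) (λ i → ray i + ray i)) (+-congˡ (diagonal 0) (Sum-+ ray ray)) ⟩
  diagonal 0 + (Sum ray + Sum ray)
    ≈⟨ +-congˡ (diagonal 0) (R.+-cong rays rays) ⟩
  diagonal 0 + (Sum (diagonal ∘ suc) + Sum (diagonal ∘ suc)) ∎
  where
  L ray : ℕ → FPS
  L i = Sum (λ m → Sum (λ d → h (i ℕ.+ m) (i ℕ.+ d)))
  ray i = Sum (λ k → h i (i ℕ.+ suc k))
  rays : Sum ray ≈ Sum (diagonal ∘ suc)
  rays = Sum-swap (λ i k → h i (i ℕ.+ suc k))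
  h-vanishingˡ : ∀ i b → Vanishing (λ m → h (i ℕ.+ m) b)
  h-vanishingˡ i b = X*-vanishing (λ m → E (i ℕ.+ m) b)
    (λ m → n≤1+2e (ℕ.≤-trans (ℕ.m≤n+m m i) (m≤E (i ℕ.+ m) b))) (λ m → 1# - X (E₂ (i ℕ.+ m) b))
  h-vanishingʳ : ∀ a i → Vanishing (λ d → h a (i ℕ.+ d))
  h-vanishingʳ a i = X*-vanishing (λ d → E a (i ℕ.+ d))
    (λ d → n≤1+2e (ℕ.≤-trans (ℕ.m≤n+m d i) (d≤E a (i ℕ.+ d)))) (λ d → 1# - X (E₂ a (i ℕ.+ d)))
  L-vanishing : Vanishing L
  L-vanishing = vanishing-Sum λ m → vanishing-Sum λ d →
    X*-vanishing (λ i → E (i ℕ.+ m) (i ℕ.+ d))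
      (λ i → n≤1+2e (ℕ.≤-trans (ℕ.m≤m+n i m) (m≤E (i ℕ.+ m) (i ℕ.+ d))))
      (λ i → 1# - X (E₂ (i ℕ.+ m) (i ℕ.+ d)))
  step : ∀ i → L i ≈ (h i (i ℕ.+ 0) + (ray i + ray i)) + L (suc i)
  step i = begin
    L i
      ≈⟨ Sum-head (vanishing-Sum λ d → h-vanishingˡ i (i ℕ.+ d)) ⟩
    Sum (f 0) + Sum (λ m → Sum (f (suc m)))
      ≈⟨ R.+-cong (Sum-head (h-vanishingʳ (i ℕ.+ 0) i))
           (R.trans (Sum-cong λ m → Sum-head (h-vanishingʳ (i ℕ.+ suc m) i))
             (Sum-+ (λ m → f (suc m) 0) (λ m → Sum (f (suc m) ∘ suc)))) ⟩
    (f 0 0 + Sum (f 0 ∘ suc)) + (Sum (λ m → f (suc m) 0) + Sum (λ m → Sum (f (suc m) ∘ suc)))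
      ≈⟨ R.+-cong (R.+-cong (h-≡ (ℕ.+-identityʳ i) ≡.refl) (Sum-cong λ d → h-≡ (ℕ.+-identityʳ i) ≡.refl))
           (R.+-cong (Sum-cong λ m → R.trans (h-sym (i ℕ.+ suc m) (i ℕ.+ 0)) (h-≡ (ℕ.+-identityʳ i) ≡.refl))
             (Sum-cong λ m → Sum-cong λ d → h-≡ (ℕ.+-suc i m) (ℕ.+-suc i d))) ⟩
    (h i (i ℕ.+ 0) + ray i) + (ray i + L (suc i))
      ≈⟨ solve 3 (λ a b c → (a :+ b) :+ (b :+ c) := (a :+ (b :+ b)) :+ c) (λ _ → ≡.refl)
           (h i (i ℕ.+ 0)) (ray i) (L (suc i)) ⟩
    (h i (i ℕ.+ 0) + (ray i + ray i)) + L (suc i) ∎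
    where
    f : ℕ → ℕ → FPS
    f m d = h (i ℕ.+ m) (i ℕ.+ d)

-- The Hecke series

-- foldPairs u n = ∑_{2a + d = n} u a d
foldPairs : (ℕ → ℕ → FPS) → ℕ → FPS
foldPairs u zero          = u 0 0
foldPairs u (suc zero)    = u 0 1
foldPairs u (suc (suc n)) = u 0 (2 ℕ.+ n) + foldPairs (u ∘ suc) n

foldPairs-cong : ∀ {u u′} → (∀ a d → u a d ≈ u′ a d) → ∀ n → foldPairs u n ≈ foldPairs u′ n
foldPairs-cong u≈ zero          = u≈ 0 0
foldPairs-cong u≈ (suc zero)    = u≈ 0 1
foldPairs-cong u≈ (suc (suc n)) = R.+-cong (u≈ 0 (2 ℕ.+ n)) (foldPairs-cong (u≈ ∘ suc) n)

foldPairs-0 : ∀ {u} k n → (∀ a d → a ℕ.* 2 ℕ.+ d ≡ n → u a d k ≡ 0ℤ) → foldPairs u n k ≡ 0ℤ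
foldPairs-0 k zero          u≡0 = u≡0 0 0 ≡.refl
foldPairs-0 k (suc zero)    u≡0 = u≡0 0 1 ≡.refl
foldPairs-0 k (suc (suc n)) u≡0 = ≡.cong₂ ℤ._+_ (u≡0 0 (2 ℕ.+ n) ≡.refl)
  (foldPairs-0 k n λ a d eq → u≡0 (suc a) d (≡.cong (2 ℕ.+_) eq))

-- The hypothesis is restricted to pairs over n because the intended `s` itself depends on n: a
-- Hecke summand takes its closed exponent only for d = n - 2a.
partialSum≈foldPairs : ∀ {s u} n → (∀ a d → a ℕ.* 2 ℕ.+ d ≡ n → s a ≈ u a d) →
  partialSum s (suc ⌊ n /2⌋) ≈ foldPairs u n
partialSum≈foldPairs {s} zero       s≈u = R.trans (R.+-identityˡ (s 0)) (s≈u 0 0 ≡.refl)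
partialSum≈foldPairs {s} (suc zero) s≈u = R.trans (R.+-identityˡ (s 0)) (s≈u 0 1 ≡.refl)
partialSum≈foldPairs {s} (suc (suc n)) s≈u = R.trans (partialSum-head s (suc ⌊ n /2⌋))
  (R.+-cong (s≈u 0 (2 ℕ.+ n) ≡.refl)
    (partialSum≈foldPairs n λ a d eq → s≈u (suc a) d (≡.cong (2 ℕ.+_) eq)))

foldPairs-vanishing : ∀ {u} → (∀ a d → OrderAtLeast (a ℕ.+ d) (u a d)) → Vanishing (foldPairs u)
foldPairs-vanishing o .Vanishing.vanishes n k c≤n = foldPairs-0 k n λ { a d ≡.refl → o a d k
  (ℕ.*-cancelˡ-≤ 2 (ℕ.≤-trans (ℕ.≤-reflexive (ℕ.*-suc 2 k)) (ℕ.≤-trans c≤n (a*2+d≤ a d)))) }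
  where
  a*2+d≤ : ∀ a d → a ℕ.* 2 ℕ.+ d ≤ 2 ℕ.* (a ℕ.+ d)
  a*2+d≤ a d = ℕ.≤-trans (ℕ.m≤m+n _ d) (ℕ.≤-reflexive
    (nsolve 2 (λ a d → a ⊗ ncon 2 ⊕ d ⊕ d ⊜ ncon 2 ⊗ (a ⊕ d)) ≡.refl a d))

-- Rearrangement by rows: the row of smallest a takes its d = 0 and d = 1 entries from n = 0 and n =
-- 1 and the others from the first summand at n + 2, while the second summand is the same series for
-- the remaining rows. `L i` holds the rows from i on.
Sum-foldPairs : ∀ {u} → (∀ a d → OrderAtLeast (a ℕ.+ d) (u a d)) →
  Sum (foldPairs u) ≈ Sum (λ a → Sum (u a))
Sum-foldPairs {u} o = Sum-telescope {L} step (vanishing λ i k c≤i → partialSum-0 k (λ n →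
  foldPairs-0 k n λ a d _ →
    o (i ℕ.+ a) d k (ℕ.≤-trans (k< c≤i) (ℕ.≤-trans (ℕ.m≤m+n i a) (ℕ.m≤m+n (i ℕ.+ a) d))))
  (cutoff k))
  where
  k< : ∀ {i k} → cutoff k ≤ i → k < i
  k< {_} {k} c≤i = ℕ.≤-trans (s≤s (ℕ.≤-trans (ℕ.m≤m+n k _) (ℕ.n≤1+n _))) c≤i
  L : ℕ → FPS
  L i = Sum (foldPairs (λ a → u (i ℕ.+ a)))
  step : ∀ i → L i ≈ Sum (u i) + L (suc i)
  step i = begin
    Sum (foldPairs w)
      ≈⟨ R.trans (Sum-head wv) (+-congˡ (w 0 0) (Sum-head (vanishing-suc wv))) ⟩
    w 0 0 + (w 0 1 + Sum (λ n → w 0 (2 ℕ.+ n) + foldPairs (w ∘ suc) n))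
      ≈⟨ +-congˡ (w 0 0) (+-congˡ (w 0 1) (Sum-+ (λ n → w 0 (2 ℕ.+ n)) (foldPairs (w ∘ suc)))) ⟩
    w 0 0 + (w 0 1 + (Sum (λ n → w 0 (2 ℕ.+ n)) + Sum (foldPairs (w ∘ suc))))
      ≈⟨ solve 4 (λ a b c d → a :+ (b :+ (c :+ d)) := (a :+ (b :+ c)) :+ d) (λ _ → ≡.refl)
           (w 0 0) (w 0 1) (Sum (λ n → w 0 (2 ℕ.+ n))) (Sum (foldPairs (w ∘ suc))) ⟩
    (w 0 0 + (w 0 1 + Sum (λ n → w 0 (2 ℕ.+ n)))) + Sum (foldPairs (w ∘ suc))
      ≈⟨ R.+-cong
           (R.trans (+-congˡ (w 0 0) (R.sym (Sum-head (vanishing-suc w0v)))) (R.sym (Sum-head w0v)))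
           (Sum-cong (foldPairs-cong λ a d → u-≡ (ℕ.+-suc i a) d)) ⟩
    Sum (w 0) + L (suc i)
      ≈⟨ +-congʳ (L (suc i)) (Sum-cong (u-≡ (ℕ.+-identityʳ i))) ⟩
    Sum (u i) + L (suc i) ∎
    where
    w : ℕ → ℕ → FPS
    w a = u (i ℕ.+ a)
    u-≡ : ∀ {a b} → a ≡ b → ∀ d → u a d ≈ u b d
    u-≡ ≡.refl d _ = ≡.refl
    ow : ∀ a d → OrderAtLeast (a ℕ.+ d) (w a d)
    ow a d k k< = o (i ℕ.+ a) d k (ℕ.<-≤-trans k< (ℕ.+-monoˡ-≤ d (ℕ.m≤n+m a i)))
    wv : Vanishing (foldPairs w)
    wv = foldPairs-vanishing ow
    w0v : Vanishing (w 0)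
    w0v = order⇒vanishing (λ d → d) (λ d → n≤1+2e ℕ.≤-refl) (ow 0)

∑<-partialSum : ∀ n (u : ℕ → FPS) k → ∑[ i < n ] u (toℕ i) k ≡ partialSum u n k
∑<-partialSum zero    u k = ≡.refl
∑<-partialSum (suc n) u k = ≡.trans
  (≡.cong (λ z → u 0 k ℤ.+ z) (∑<-partialSum n (u ∘ suc) k)) (≡.sym (partialSum-head u n k))

±pair : (ℤ → FPS) → ℕ → FPS
±pair t zero    = t (+ 0)
±pair t (suc b) = t (+ suc b) + t -[1+ b ]

-- Passing from N to N + 1 adds one index at each end of the range. Dropping the first index cancels
-- the successor against that of N + 1, so the middle is the sum for N.
∑±-pairs : ∀ N t → ∑± N t ≈ partialSum (±pair t) (suc N)
∑±-pairs N t = R.trans (∑<-partialSum (suc (2 ℕ.* N)) (λ i → t (i ⊖ N))) (pairs N)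
  where
  t-≡ : ∀ {i j} → i ≡ j → t i ≈ t j
  t-≡ ≡.refl _ = ≡.refl
  last : ∀ N → suc (2 ℕ.* N) ⊖ N ≡ + suc N
  last N = ≡.trans (ℤ.⊖-≥ (ℕ.≤-trans (ℕ.m≤m+n N _) (ℕ.n≤1+n _))) (≡.cong +_
    (≡.trans (≡.cong (_∸ N) (nsolve 1 (λ n → ncon 1 ⊕ ncon 2 ⊗ n ⊜ (ncon 1 ⊕ n) ⊕ n) ≡.refl N))
      (ℕ.m+n∸n≡m (suc N) N)))
  pairs : ∀ N → partialSum (λ i → t (i ⊖ N)) (suc (2 ℕ.* N)) ≈ partialSum (±pair t) (suc N)
  pairs zero    = λ _ → ≡.refl
  pairs (suc N) = begin
    partialSum s (suc (2 ℕ.* suc N))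
      ≈⟨ (λ k → ≡.cong (λ n → partialSum s (suc n) k) (ℕ.*-suc 2 N)) ⟩
    partialSum s (3 ℕ.+ 2 ℕ.* N)
      ≈⟨ partialSum-head s (2 ℕ.+ 2 ℕ.* N) ⟩
    t -[1+ N ] + (partialSum (s ∘ suc) (suc (2 ℕ.* N)) + s (2 ℕ.+ 2 ℕ.* N))
      ≈⟨ +-congˡ (t -[1+ N ]) (R.+-cong
           (λ k → partialSum-cong k (λ i → t-≡ (ℤ.[1+m]⊖[1+n]≡m⊖n i N) k) (suc (2 ℕ.* N)))
           (t-≡ (≡.trans (ℤ.[1+m]⊖[1+n]≡m⊖n (suc (2 ℕ.* N)) N) (last N)))) ⟩
    t -[1+ N ] + (partialSum (λ i → t (i ⊖ N)) (suc (2 ℕ.* N)) + t (+ suc N))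
      ≈⟨ +-congˡ (t -[1+ N ]) (+-congʳ (t (+ suc N)) (pairs N)) ⟩
    t -[1+ N ] + (partialSum (±pair t) (suc N) + t (+ suc N))
      ≈⟨ solve 3 (λ a b c → a :+ (b :+ c) := b :+ (c :+ a)) (λ _ → ≡.refl)
           (t -[1+ N ]) (partialSum (±pair t) (suc N)) (t (+ suc N)) ⟩
    partialSum (±pair t) (2 ℕ.+ N) ∎
    where
    s : ℕ → FPS
    s i = t (i ⊖ suc N)

heckePair : ℕ → ℕ → FPS
heckePair zero    d = X (E 0 d)
heckePair (suc b) d = X (E (suc b) d) + (- (X (E b d) * X (E₂ b d)))

heckeTerm≈foldPairs : ∀ n → heckeTerm n ≈ foldPairs heckePair n
heckeTerm≈foldPairs n = R.trans (∑±-pairs ⌊ n /2⌋ t) (partialSum≈foldPairs n pair)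
  where
  t : ℤ → FPS
  t m = sgn m • q ^ exponent n m
  pair : ∀ a d → a ℕ.* 2 ℕ.+ d ≡ n → ±pair t a ≈ heckePair a d
  pair zero    d ≡.refl = R.trans (λ k → ℤ.*-identityˡ _) (X-≡ (exponent-+ 0 d))
  pair (suc b) d ≡.refl = R.+-cong
    (R.trans (λ k → ℤ.*-identityˡ _) (X-≡ (exponent-+ (suc b) d)))
    (R.trans (λ k → ℤ.-1*i≡-i _)
      (R.-‿cong (R.trans (X-≡ (exponent-- b d)) (X-+ (E b d) (E₂ b d)))))

-- `heckePair` joins m = a with -a, as equal n requires, and row 0 has no negative partner.
-- Splitting off that row frees the negative parts, indexed by b = a - 1, which are then reattached
-- to row b to give `h b`.
heckeSum≈square : heckeSum ≈ Sum (λ m → Sum (h m))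
heckeSum≈square = begin
  heckeSum
    ≈⟨ ∑∞≈Sum (vanishing-cong (λ n → R.sym (heckeTerm≈foldPairs n)) (foldPairs-vanishing order)) hecke-summable ⟩
  Sum heckeTerm
    ≈⟨ R.trans (Sum-cong heckeTerm≈foldPairs) (Sum-foldPairs order) ⟩
  Sum (λ a → Sum (heckePair a))
    ≈⟨ Sum-head (vanishing-Sum λ d → order⇒vanishing (λ a → a ℕ.+ d) (λ a → n≤1+2e (ℕ.m≤m+n a d))
         (λ a → order a d)) ⟩
  p 0 + Sum (λ b → Sum (heckePair (suc b)))
    ≈⟨ +-congˡ (p 0) (R.trans (Sum-cong λ b → Sum-+ (x (suc b)) (y b)) (Sum-+ (p ∘ suc) (λ b → Sum (y b)))) ⟩
  p 0 + (Sum (p ∘ suc) + Sum (λ b → Sum (y b)))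
    ≈⟨ R.+-assoc (p 0) (Sum (p ∘ suc)) (Sum (λ b → Sum (y b))) ⟨
  (p 0 + Sum (p ∘ suc)) + Sum (λ b → Sum (y b))
    ≈⟨ +-congʳ (Sum (λ b → Sum (y b))) (Sum-head (vanishing-Sum λ d → order⇒vanishing (λ a → E a d)
         (λ a → n≤1+2e (m≤E a d)) (λ a → order-^ q ≡.refl (E a d)))) ⟨
  Sum p + Sum (λ b → Sum (y b))
    ≈⟨ Sum-+ p (λ b → Sum (y b)) ⟨
  Sum (λ m → p m + Sum (y m))
    ≈⟨ Sum-cong (λ m → R.trans (R.sym (Sum-+ (x m) (y m))) (Sum-cong λ d → factor (x m d) (X (E₂ m d)))) ⟩
  Sum (λ m → Sum (h m)) ∎
  where
  x y : ℕ → ℕ → FPS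
  x m d = X (E m d)
  y m d = - (X (E m d) * X (E₂ m d))
  p : ℕ → FPS
  p m = Sum (x m)
  factor : ∀ a b → a + (- (a * b)) ≈ a * (1# - b)
  factor = solve 2 (λ a b → a :+ (:- (a :* b)) := a :* (con 1ℤ :- b)) (λ _ → ≡.refl)
  m+d≤E : ∀ m d → m ℕ.+ d ≤ E m d
  m+d≤E m d = ℕ.+-mono-≤ (ℕ.≤-trans (ℕ.m≤m+n m (T m)) (ℕ.m≤m+n _ (2 ℕ.* (m ℕ.* d)))) (ℕ.m≤m+n d (T d))
  order : ∀ a d → OrderAtLeast (a ℕ.+ d) (heckePair a d)
  order zero    d k k< = order-^ q ≡.refl (E 0 d) k (ℕ.<-≤-trans k< (m+d≤E 0 d))
  order (suc b) d k k< = ≡.cong₂ ℤ._+_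
    (order-^ q ≡.refl (E (suc b) d) k (ℕ.<-≤-trans k< (m+d≤E (suc b) d)))
    (≡.cong ℤ.-_ (≡.trans (≡.sym (X-+ (E b d) (E₂ b d) k)) (order-^ q ≡.refl (E b d ℕ.+ E₂ b d) k
      (ℕ.<-≤-trans k< (ℕ.≤-trans (ℕ.m≤m+n (suc b ℕ.+ d) _) (ℕ.m≤n+m (E₂ b d) (E b d)))))))

ψ*f≈heckeSum : triangularSum * mockThetaF ≈ heckeSum
ψ*f≈heckeSum = R.trans ψ*f≈diagonals (R.trans (R.sym square≈diagonals) (R.sym heckeSum≈square))

-- Gauss: ψ(q) (q;q)_∞ = (q²;q²)²_∞

-- Congruence modulo q^L, which takes the place of limits: each coefficient is compared at a
-- sufficiently late truncation.
Agree : ℕ → FPS → FPS → Set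
Agree L a b = ∀ k → k < L → a k ≡ b k

agree-* : ∀ {L} {a a′ b b′} → Agree L a a′ → Agree L b b′ → Agree L (a * b) (a′ * b′)
agree-* p r k k<L = sum-cong-≗ {suc k} λ i → ≡.cong₂ ℤ._*_
  (p (toℕ i) (ℕ.≤-<-trans (toℕ≤pred[n] i) k<L)) (r (k ∸ toℕ i) (ℕ.≤-<-trans (ℕ.m∸n≤m k (toℕ i)) k<L))

agree-+ : ∀ {L} a {b} → OrderAtLeast L b → Agree L (a + b) a
agree-+ a o k k<L = ≡.trans (≡.cong (λ z → a k ℤ.+ z) (o k k<L)) (ℤ.+-identityʳ (a k))

order-≤ : ∀ {l m a} → l ≤ m → OrderAtLeast m a → OrderAtLeast l a
order-≤ l≤m o k k<l = o k (ℕ.<-≤-trans k<l l≤m)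

order-Sum : ∀ {L t} → (∀ n → OrderAtLeast L (t n)) → OrderAtLeast L (Sum t)
order-Sum o k k<L = partialSum-0 k (λ n → o n k k<L) (cutoff k)

-- Modulo q^m the second summand of `Y-recˡ` disappears, so `Y (suc m)` may be replaced by `Y m` and
-- `Y-recʳ` becomes a recurrence in s alone. Behind it is Euler's ∑ⱼ (-1)ʲ q^{j(j-1)/2} xʲ/(q;q)ⱼ =
-- (x;q)_∞, whose left side at x = q^s is the limit of `Y m s` for growing m.
Y-agree-factor : ∀ m s → Agree m (Y m s) ((1# - X s) * Y m (suc s))
Y-agree-factor m s k k<m = ≡R.begin
  Y m s k
    ≡R.≡⟨ Y-recˡ m s k ⟩
  (Y (suc m) s + X (m ℕ.+ s) * Y (suc m) (suc s)) k
    ≡R.≡⟨ agree-+ (Y (suc m) s) (order s) k k<m ⟩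
  Y (suc m) s k
    ≡R.≡⟨ solve 2 (λ a b → a := (a :+ b) :- b) (λ _ → ≡.refl) (Y (suc m) s) (X s * Y (suc m) (suc s)) k ⟩
  ((Y (suc m) s + X s * Y (suc m) (suc s)) - X s * Y (suc m) (suc s)) k
    ≡R.≡⟨ ≡.cong₂ ℤ._-_ (≡.sym (Y-recʳ m s k)) (agree-* {m} {X s} (λ _ _ → ≡.refl) Y≡ k k<m) ⟩
  (Y m (suc s) - X s * Y m (suc s)) k
    ≡R.≡⟨ solve 2 (λ x y → y :- x :* y := (con 1ℤ :- x) :* y) (λ _ → ≡.refl) (X s) (Y m (suc s)) k ⟩
  ((1# - X s) * Y m (suc s)) k ≡R.∎
  where
  order : ∀ s → OrderAtLeast m (X (m ℕ.+ s) * Y (suc m) (suc s))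
  order s = order-≤ (ℕ.m≤m+n m s) (order-X* (m ℕ.+ s) (Y (suc m) (suc s)))
  Y≡ : Agree m (Y (suc m) (suc s)) (Y m (suc s))
  Y≡ j j<m = ≡.sym (≡.trans (Y-recˡ m (suc s) j) (agree-+ (Y (suc m) (suc s)) (order (suc s)) j j<m))

Y-agree-poch : ∀ m n → Agree m (Y m 1) (poch q q n * Y m (suc n))
Y-agree-poch m zero    k k<m = ≡.sym (*-identityˡ (Y m 1) k)
Y-agree-poch m (suc n) k k<m = ≡.trans (Y-agree-poch m n k k<m)
  (≡.trans (agree-* {m} {poch q q n} (λ _ _ → ≡.refl) (Y-agree-factor m (suc n)) k k<m)
    (solve 3 (λ p f y → p :* (f :* y) := f :* p :* y) (λ _ → ≡.refl)
      (poch q q n) (1# - X (suc n)) (Y m (2 ℕ.+ n)) k))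

Y-agree-1 : ∀ m s → Agree s (Y m s) 1#
Y-agree-1 m s k k<s = ≡.trans (Sum-head (YTerm-vanishing m s) k)
  (≡.trans (agree-+ (1# * 1#) (order-Sum λ j → order-≤ (s≤ j) (order-X* _ (c m (suc j)))) k k<s)
    (*-identityˡ 1# k))
  where
  s≤ : ∀ j → s ≤ suc j ℕ.* s ℕ.+ T (suc j)
  s≤ j = ℕ.≤-trans (ℕ.m≤m+n s (j ℕ.* s)) (ℕ.m≤m+n (suc j ℕ.* s) (T (suc j)))

-- For k ≥ 1 the factor q^{nk} in `v n k` is 0 modulo qⁿ, so only `v n 0` = `Y (suc (n ℕ.* 2)) 1`
-- remains. Splitting n factors off it leaves `Y (suc (n ℕ.* 2)) (suc n)`, which is 1 to this order.
W-agree-poch : ∀ n → Agree n (W n) (poch q q n)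
W-agree-poch n k k<n = ≡.trans
  (agree-+ (v n 0) (λ j j<n → ≡.cong₂ ℤ._+_ (tail-order j j<n) (tail-order j j<n)) k k<n)
  (≡.trans (v-zero n k)
  (≡.trans (Y-agree-poch (suc (n ℕ.* 2)) n k
    (ℕ.<-≤-trans k<n (ℕ.m≤n⇒m≤1+n (ℕ.m≤m*n n 2))))
  (≡.trans (agree-* {n} {poch q q n} (λ _ _ → ≡.refl)
    (λ j j<n → Y-agree-1 (suc (n ℕ.* 2)) (suc n) j (ℕ.m≤n⇒m≤1+n j<n)) k k<n)
  (R.*-identityʳ (poch q q n) k))))
  where
  tail-order : OrderAtLeast n (Sum (v n ∘ suc))
  tail-order = order-Sum λ j → order-≤
    (ℕ.≤-trans (ℕ.m≤m*n n (suc j)) (ℕ.m≤m+n (n ℕ.* suc j) (T (2 ℕ.+ j))))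
    (order-X* (n ℕ.* suc j ℕ.+ T (2 ℕ.+ j)) (Y (suc (n ℕ.* 2)) (2 ℕ.+ j)))

poch∞-agree : ∀ a b b₀ n → Agree n (poch∞ a b b₀) (poch a b n)
poch∞-agree a b b₀ n k k<n = ≡.sym (proj₂ (poch-convergent a b b₀ k) n k<n)

poch-q² : ∀ n → poch (q ^ 2) (q ^ 2) n ≈ poch q q n * poch (- q) q n
poch-q² zero    = R.sym (R.*-identityˡ 1#)
poch-q² (suc n) = begin
  (1# - q ^ 2 * (q ^ 2) ^ n) * poch (q ^ 2) (q ^ 2) n
    ≈⟨ *-cong (+-congˡ 1# (R.-‿cong (*-congˡ (q ^ 2) (square n)))) (poch-q² n) ⟩
  (1# - q ^ 2 * (X n * X n)) * (poch q q n * poch (- q) q n)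
    ≈⟨ *-congʳ (poch q q n * poch (- q) q n)
         (solve 2 (λ q x → con 1ℤ :- (q :* (q :* con 1ℤ)) :* (x :* x)
           := (con 1ℤ :- q :* x) :* (con 1ℤ :- (:- q) :* x)) (λ _ → ≡.refl) q (X n)) ⟩
  (1# - q * X n) * (1# - (- q) * X n) * (poch q q n * poch (- q) q n)
    ≈⟨ solve 4 (λ a b p r → a :* b :* (p :* r) := a :* p :* (b :* r)) (λ _ → ≡.refl)
         (1# - q * X n) (1# - (- q) * X n) (poch q q n) (poch (- q) q n) ⟩
  poch q q (suc n) * poch (- q) q (suc n) ∎
  where
  square : ∀ n → (q ^ 2) ^ n ≈ X n * X n
  square zero    = R.sym (R.*-identityˡ 1#)
  square (suc n) = R.trans (*-congˡ (q ^ 2) (square n))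
    (solve 2 (λ q x → (q :* (q :* con 1ℤ)) :* (x :* x) := (q :* x) :* (q :* x)) (λ _ → ≡.refl) q (X n))

-- Coefficient k is settled modulo q^{k+1}: with n = k + 1, ψ = (-q;q)ₙ² Wₙ and Wₙ ≡ (q;q)ₙ make the
-- left side the square of (q;q)ₙ(-q;q)ₙ = (q²;q²)ₙ.
gauss : triangularSum * ⟨q⨾q⟩∞ ≈ ⟨q²⨾q²⟩∞ ^ 2
gauss k = ≡.trans (finite k ℕ.≤-refl)
  (≡.sym (agree-* Q (agree-* {b = 1#} Q (λ _ _ → ≡.refl)) k ℕ.≤-refl))
  where
  n : ℕ
  n = suc k
  Q : Agree n ⟨q²⨾q²⟩∞ (poch (q ^ 2) (q ^ 2) n)
  Q = poch∞-agree (q ^ 2) (q ^ 2) ≡.refl n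
  p p₋ : FPS
  p  = poch q q n
  p₋ = poch (- q) q n
  finite : Agree n (triangularSum * ⟨q⨾q⟩∞) (poch (q ^ 2) (q ^ 2) n ^ 2)
  finite j j<n = ≡R.begin
    (triangularSum * ⟨q⨾q⟩∞) j
      ≡R.≡⟨ *-congʳ ⟨q⨾q⟩∞ (triangularSum≈D*W n) j ⟩
    (mockThetaDenominator n * W n * ⟨q⨾q⟩∞) j
      ≡R.≡⟨ agree-* (agree-* {n} {mockThetaDenominator n} (λ _ _ → ≡.refl) (W-agree-poch n))
             (poch∞-agree q q ≡.refl n) j j<n ⟩
    (p₋ * (p₋ * 1#) * p * p) j
      ≡R.≡⟨ solve 2 (λ a b → a :* (a :* con 1ℤ) :* b :* b := (b :* a) :* ((b :* a) :* con 1ℤ)) (λ _ → ≡.refl)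
             p₋ p j ⟩
    ((p * p₋) ^ 2) j
      ≡R.≡⟨ ^-congˡ 2 (poch-q² n) j ⟨
    (poch (q ^ 2) (q ^ 2) n ^ 2) j ≡R.∎

mainTheorem2 : (mockThetaF ≈ ⟨q⨾q⟩∞ * recip (⟨q²⨾q²⟩∞ ^ 2) ⟨q²⨾q²⟩∞²-const * heckeSum)
    ×
    (triangularSum * mockThetaF ≈ heckeSum)
mainTheorem2 = quotientForm , ψ*f≈heckeSum
  where
  r : FPS
  r = recip (⟨q²⨾q²⟩∞ ^ 2) ⟨q²⨾q²⟩∞²-const
  quotientForm : mockThetaF ≈ ⟨q⨾q⟩∞ * r * heckeSum
  quotientForm = begin
    mockThetaF
      ≈⟨ R.*-identityˡ mockThetaF ⟨
    1# * mockThetaF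
      -- By `gauss` the prefactor of the Hecke sum is the inverse of ψ, so 1 can be expanded as ψ
      -- times that prefactor.
      ≈⟨ *-congʳ mockThetaF (R.trans (*-congʳ r gauss) (*-recip (⟨q²⨾q²⟩∞ ^ 2) ⟨q²⨾q²⟩∞²-const)) ⟨
    triangularSum * ⟨q⨾q⟩∞ * r * mockThetaF
      ≈⟨ solve 4 (λ t p r f → t :* p :* r :* f := p :* r :* (t :* f)) (λ _ → ≡.refl)
           triangularSum ⟨q⨾q⟩∞ r mockThetaF ⟩
    ⟨q⨾q⟩∞ * r * (triangularSum * mockThetaF)
      ≈⟨ *-congˡ (⟨q⨾q⟩∞ * r) ψ*f≈heckeSum ⟩
    ⟨q⨾q⟩∞ * r * heckeSum ∎
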